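{- Let $n,m$ be positive integers with $2(m+1)\leq n$, let $G=C^m_n$ (the $m$-th power of the cycle $C_n$, with vertex set $[n]$ and addition modulo $n$), and let $\mathcal R=\{G_i:i\in [n]\}$ be a family of graphs. Let $\mathcal I_2$ denote the family of independent sets of $C_n^m$ with cardinality at least two. Then $$\gamma_{gr}(G\hookleftarrow \mathcal R)= \max_{I \in \mathcal I_2} \left\{\sum_{i\in I} \gamma_{gr} (G_i)- |I|(m+1)\right\} + n.$$ Moreover, given a Grundy dominating sequence $S_i$ of $G_i$ for all $i\in [n]$, and given $I^*\in \mathcal I_2$ such that $$\sum_{i\in I^*} \gamma_{gr} (G_i)- |I^*|(m+1)=\max_{I \in \mathcal I_2} \left\{\sum_{i\in I} \gamma_{gr} (G_i)- |I|(m+1)\right\},$$ the sequence $S$ obtained from $S_C(I^*)$ by replacing each $i\in I^*$ by $S_i$ is a Grundy dominating sequence of $G\hookleftarrow \mathcal R$.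
   Context: $G\hookleftarrow \mathcal R$ denotes the $X$-join product: the graph obtained from $G$ by replacing each vertex $v$ by the graph $G_v\in\mathcal R$ (vertices of $G_u$ and $G_v$ are all adjacent iff $uv\in E(G)$). For a sequence $S=(v_1,\dots,v_k)$ of distinct vertices, $PN_S(v_i)=N[v_i]\setminus\bigcup_{j<i}N[v_j]$; $S$ is a legal dominating sequence if its vertex set dominates the graph and every $PN_S(v_i)\neq\emptyset$. A Grundy dominating sequence is a legal dominating sequence of maximum length, and $\gamma_{gr}$ (Grundy domination number) is that length. For $1\leq i\leq j\leq n$, $S(i,j)=(i,i+1,\dots,j)$, and $S^{ -1}$ is $S$ in reverse order; $\oplus$ is concatenation of sequences. For $I=\{i^1<\dots<i^p\}\in\mathcal I_2$, $S_j=S(i^j,i^{j+1}-(m+1))$ for $j\in[p-1]$, $S_p=S^{ -1}(i^p+(m+1),i^1-1)$ if $i^p+(m+1)\neq i^1$ and $S_p=(\;)$ otherwise, and $S_C(I)=\left(\bigoplus_{j=1}^{p-1}S_j\right)\oplus S_p\oplus(i^p)$; it is a legal dominating sequence of $C_n^m$ of length $n-|I|m$. -}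

module Defs where

open import Data.Nat using (ℕ; zero; suc; _+_; _*_; _∸_; _≤_; _<_; NonZero; z≤n; s≤s)
open import Data.Nat.DivMod using (_mod_)
open import Data.Fin using (Fin; toℕ; _≟_)
open import Data.Integer as ℤ using (ℤ; +_)
open import Data.List using (List; []; _∷_; _++_; [_]; _∷ʳ_; map; reverse; upTo; length; concatMap)
open import Data.Nat.ListAction using (sum)
open import Data.List.Relation.Unary.All using (All)
open import Data.List.Relation.Unary.Any using (Any)
open import Data.List.Relation.Unary.AllPairs using (AllPairs)
open import Data.List.Relation.Unary.Unique.Propositional using (Unique)
open import Data.Product using (Σ; ∃; _×_; _,_)
open import Data.Sum using (_⊎_)
open import Data.Unit using (⊤)
open import Relation.Nullary using (¬_; does)
open import Relation.Binary.PropositionalEquality using (_≡_)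
import Data.List.Membership.DecPropositional
import Data.Nat.Properties
open import Data.Bool using (if_then_else_)

record FinGraph : Set₁ where
  field
    size     : ℕ
    Adj      : Fin size → Fin size → Set
    adj-sym  : ∀ {x y} → Adj x y → Adj y x
    adj-irr  : ∀ {x} → ¬ Adj x x

module _ {V : Set} (Adj : V → V → Set) where

  CN : V → V → Set
  CN u w = w ≡ u ⊎ Adj u w

  Footprints : List V → List V → Set
  Footprints pre []      = ⊤
  Footprints pre (v ∷ S) =
    (∃ λ w → CN v w × All (λ u → ¬ CN u w) pre) × Footprints (pre ∷ʳ v) S

  Dominates : List V → Set
  Dominates S = ∀ w → Any (λ u → CN u w) S

  LegalDominating : List V → Set
  LegalDominating S = Unique S × Footprints [] S × Dominates S

  GrundySeq : List V → Set
  GrundySeq S = LegalDominating S × (∀ S′ → LegalDominating S′ → length S′ ≤ length S)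

  GrundyNumber : ℕ → Set
  GrundyNumber k = (∃ λ S → LegalDominating S × length S ≡ k)
                 × (∀ S′ → LegalDominating S′ → length S′ ≤ k)

-- The m-th power of the cycle C_n on Fin n (labels 0..n-1).
-- Step n i j k : j ≡ i + k (mod n), for 0 < k < n.

Step : (n : ℕ) → Fin n → Fin n → ℕ → Set
Step n i j k = toℕ j ≡ toℕ i + k ⊎ toℕ j + n ≡ toℕ i + k

CAdj : (n m : ℕ) → Fin n → Fin n → Set
CAdj n m i j = ∃ λ k → 1 ≤ k × k ≤ m × (Step n i j k ⊎ Step n j i k)

IsI2 : (n m : ℕ) → List (Fin n) → Set
IsI2 n m I = AllPairs (λ a b → toℕ a < toℕ b) I
           × AllPairs (λ a b → ¬ CAdj n m a b) I
           × 2 ≤ length I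

obj : {n : ℕ} → (m : ℕ) → (Fin n → ℕ) → List (Fin n) → ℤ
obj m g I = + sum (map g I) ℤ.- + (length I * (m + 1))

range : ℕ → ℕ → List ℕ
range a b = map (λ t → a + t) (upTo (suc b ∸ a))

blocks : (m : ℕ) → List ℕ → List ℕ
blocks m (a ∷ b ∷ rest) = range a (b ∸ (m + 1)) ++ blocks m (b ∷ rest)
blocks m _              = []

lastOr : ℕ → List ℕ → ℕ
lastOr d []       = d
lastOr d (x ∷ xs) = lastOr x xs

SC : (n m : ℕ) → .{{NonZero n}} → List (Fin n) → List (Fin n)
SC n m I with map toℕ I
... | []          = []
... | ns@(i1 ∷ _) =
  let ip = lastOr i1 ns
      -- S_p = S⁻¹(iᵖ+(m+1), i¹−1), cyclically (empty iff iᵖ+(m+1) ≡ i¹ mod n)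
      Sp = reverse (map (λ t → ip + (m + 1) + t) (upTo (i1 + n ∸ (ip + (m + 1)))))
  in map (_mod n) (blocks m ns ++ Sp ++ [ ip ])

nz : ∀ {n m} → 2 * (m + 1) ≤ n → NonZero n
nz {suc n} _ = _
nz {zero} {m} h with h
... | p rewrite Data.Nat.Properties.+-comm m 1 with p
... | ()

module _ (n m : ℕ) (R : Fin n → FinGraph) where

  JV : Set
  JV = Σ (Fin n) (λ i → Fin (FinGraph.size (R i)))

  data JAdj : JV → JV → Set where
    inner : ∀ {i x y} → FinGraph.Adj (R i) x y → JAdj (i , x) (i , y)
    outer : ∀ {i j x y} → CAdj n m i j → JAdj (i , x) (j , y)

  module Mem = Data.List.Membership.DecPropositional {A = Fin n} _≟_

  expand : (c : (i : Fin n) → Fin (FinGraph.size (R i)))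
         → (S : (i : Fin n) → List (Fin (FinGraph.size (R i))))
         → List (Fin n) → List (Fin n) → List JV
  expand c S I = concatMap (λ j → if does (Mem._∈?_ j I)
                                    then map (j ,_) (S j) else [ (j , c j) ])

{-# OPTIONS --safe #-}
module Submission where

-- Given a legal sequence of the join, send each vertex to its layer if the layer of its footprint has no
-- visited closed neighbour; this gives a legal sequence T of C_n^m.  Any other vertex is charged to the layer i
-- of its footprint: i was visited before and its neighbours were not, so the layers i that are charged form an
-- independent set of vertices of T footprinting themselves, and the vertices charged to i yield, together with
-- its first visit, a legal sequence of G_i.  If I is the set of self-footprinting vertices of T, then T misses m
-- consecutive positions between any two cyclically consecutive elements of I: around the vertex footprinted by
-- the latest member of T in that arc, nothing else has been visited.  Hence |T| ≤ n − |I| m, which gives the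
-- upper bound.  It is attained by S_C(I), where an element of I footprints itself, any other i footprints i + m
-- in the blocks S_j with j < p, and i − m in the reversed block S_p.

open import Defs
open import Data.Bool using (if_then_else_)
open import Data.Fin as Fin using (Fin; toℕ)
open import Data.Fin.Properties using (toℕ-fromℕ<; toℕ-injective; toℕ<n)
import Data.Integer.Properties as ℤₚ
import Data.Integer.Tactic.RingSolver as ℤSolver
open import Data.List using (List; []; _∷_; _++_; _∷ʳ_; [_]; length; map; concatMap; filter; reverse; upTo; applyUpTo; allFin)
-- The solver macros need unambiguous names for the list constructors.
open import Data.List using () renaming (_∷_ to _&_; [] to ∙)
import Data.List.Extrema ℤₚ.≤-totalOrder as Extrema
open import Data.List.Membership.Propositional using (_∈_; _∉_)
open import Data.List.Membership.Propositional.Properties using (∈-++⁺ˡ; ∈-++⁺ʳ; ∈-map⁺; ∈-allFin; ∈-filter⁺; ∈-concatMap⁺)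
open import Data.List.Properties using (++-assoc; ++-identityʳ; length-++; length-map; length-reverse; length-applyUpTo; map-++; concatMap-++; map-applyUpTo; unfold-reverse; reverse-++)
open import Data.List.Relation.Unary.All as All using (All; []; _∷_; all?)
import Data.List.Relation.Unary.All.Properties as Allₚ
open import Data.List.Relation.Unary.AllPairs as AllPairs using (AllPairs; []; _∷_; allPairs?)
import Data.List.Relation.Unary.AllPairs.Properties as AllPairsₚ
open import Data.List.Relation.Unary.Any as Any using (Any; here; there; any?)
import Data.List.Relation.Unary.Any.Properties as Anyₚ
open import Data.List.Relation.Unary.Unique.Propositional using (Unique)
open import Data.Nat using (ℕ; zero; suc; _+_; _*_; _∸_; _≤_; _<_; _≮_; _≤?_; _<?_; _≟_; z≤n; s≤s; z<s; NonZero)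
open import Data.Nat.DivMod using (_mod_; _%_; m%n<n; m<n⇒m%n≡m; [m+n]%n≡m%n; %-distribˡ-+)
open import Data.Nat.ListAction using (sum)
open import Data.Nat.Properties
open import Data.Nat.Tactic.RingSolver using (solve)
open import Data.Product using (Σ; ∃; ∃₂; _×_; _,_; proj₁; proj₂)
open import Data.Product.Properties using (≡-dec)
open import Data.Sum using (_⊎_; inj₁; inj₂; [_,_]′; swap; map₂)
open import Data.Unit using (⊤; tt)
open import Function using (_∘_; id)
open import Relation.Binary.Definitions using (tri<; tri≈; tri>)
open import Relation.Binary.PropositionalEquality using (_≡_; _≢_; refl; sym; trans; cong; cong₂; subst)
open import Relation.Nullary using (Dec; yes; no; does; ¬_; ¬?; contradiction; ¬¬-excluded-middle)
open import Relation.Nullary.Decidable using (map′; _×-dec_; _⊎-dec_; decidable-stable)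

infixl 5 _⊕_
_⊕_ : ∀ {a b c d} → a ≤ b → c ≤ d → a + c ≤ b + d
_⊕_ = +-mono-≤

-- Farkas certificate: the hypothesis l ≤ r (a sum of inequalities) and the slack y give p ≤ q.
lin : ∀ {p q l r} → l ≤ r → ∀ y → p + r + y ≡ q + l → p ≤ q
lin {p} {q} {l} {r} h y e = +-cancelʳ-≤ r p q
  (≤-trans (m≤m+n (p + r) y) (≤-trans (≤-reflexive e) (+-monoʳ-≤ q h)))

-- Residues modulo `n`, and adjacency in the cycle power read off integer positions.

module Cyclic (n m : ℕ) .{{_ : NonZero n}} where

  toℕ-mod : ∀ p → toℕ (p mod n) ≡ p % n
  toℕ-mod p = toℕ-fromℕ< (m%n<n p n)

  mod-≡ : ∀ {p q} → p % n ≡ q % n → p mod n ≡ q mod n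
  mod-≡ {p} {q} e = toℕ-injective (trans (toℕ-mod p) (trans e (sym (toℕ-mod q))))

  toℕ-mod-id : ∀ (v : Fin n) → toℕ v mod n ≡ v
  toℕ-mod-id v = toℕ-injective (trans (toℕ-mod (toℕ v)) (m<n⇒m%n≡m (toℕ<n v)))

  [p+n]-mod : ∀ p → (p + n) mod n ≡ p mod n
  [p+n]-mod p = mod-≡ ([m+n]%n≡m%n p n)

  mod-lift : ∀ {p} {v : Fin n} → p mod n ≡ v → p mod n ≡ toℕ v mod n
  mod-lift {_} {v} e = trans e (sym (toℕ-mod-id v))

  +-cong-mod : ∀ {p q} k → p mod n ≡ q mod n → (p + k) mod n ≡ (q + k) mod n
  +-cong-mod {p} {q} k e = mod-≡ (trans (%-distribˡ-+ p k n)
    (trans (cong (λ x → (x + k % n) % n) e′) (sym (%-distribˡ-+ q k n))))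
    where
    e′ : p % n ≡ q % n
    e′ = trans (sym (toℕ-mod p)) (trans (cong toℕ e) (toℕ-mod q))

  -- Adding `n ∸ k` undoes the shift by `k` up to a full turn; `k ≤ n` keeps the truncated
  -- subtraction exact.
  +-cancel-mod : ∀ {p q} k → k ≤ n → (p + k) mod n ≡ (q + k) mod n → p mod n ≡ q mod n
  +-cancel-mod {p} {q} k k≤n e = trans (sym (back p)) (trans (+-cong-mod (n ∸ k) e) (back q))
    where
    back : ∀ x → (x + k + (n ∸ k)) mod n ≡ x mod n
    back x = trans (cong (_mod n) (trans (+-assoc x k _) (cong (x +_) (m+[n∸m]≡n k≤n)))) ([p+n]-mod x)

  mod-step : ∀ p k → k < n → Step n (p mod n) ((p + k) mod n) k
  mod-step p k k<n = go
    where
    x = toℕ (p mod n)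
    x<n : x < n
    x<n = toℕ<n (p mod n)
    e : (p + k) mod n ≡ (x + k) mod n
    e = +-cong-mod k (sym (toℕ-mod-id (p mod n)))
    go : Step n (p mod n) ((p + k) mod n) k
    go with x + k <? n
    ... | yes lt = inj₁ (trans (cong toℕ e) (trans (toℕ-mod (x + k)) (m<n⇒m%n≡m lt)))
    ... | no ≥n = inj₂ (trans (cong (_+ n) (trans (cong toℕ e) (trans (toℕ-mod (x + k)) e₂)))
                              (m∸n+n≡m n≤))
      where
      n≤ : n ≤ x + k
      n≤ = ≮⇒≥ ≥n
      e₁ : (x + k ∸ n) + n ≡ x + k
      e₁ = m∸n+n≡m n≤
      e₂ : (x + k) % n ≡ x + k ∸ n
      e₂ = trans (cong (_% n) (sym e₁)) (trans ([m+n]%n≡m%n (x + k ∸ n) n)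
             (m<n⇒m%n≡m (+-cancelʳ-< n _ _ (subst (_< n + n) (sym e₁) (+-mono-<-≤ x<n (<⇒≤ k<n))))))

  step-mod : ∀ {v w k p} → Step n v w k → p mod n ≡ v → (p + k) mod n ≡ w
  step-mod {v} {w} {k} {p} s e = trans (+-cong-mod {p} {toℕ v} k (mod-lift e)) (go s)
    where
    go : Step n v w k → (toℕ v + k) mod n ≡ w
    go (inj₁ q) = trans (cong (_mod n) (sym q)) (toℕ-mod-id w)
    go (inj₂ q) = trans (cong (_mod n) (sym q)) (trans ([p+n]-mod (toℕ w)) (toℕ-mod-id w))

  -- The difference `d` would be a step from a residue to itself, so the two forms of `Step` force
  -- it to be 0 or `n`.
  mod-≢ : ∀ {p q} → p < q → q < p + n → p mod n ≢ q mod n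
  mod-≢ {p} {q} p<q q<p+n e with m≤n⇒∃[o]m+o≡n (<⇒≤ p<q)
  ... | d , refl with mod-step p d (+-cancelˡ-< p d n q<p+n)
  ... | inj₁ s = <⇒≢ p<q (trans (sym (+-identityʳ p)) (cong (p +_) (sym d≡0)))
    where
    d≡0 : d ≡ 0
    d≡0 = +-cancelˡ-≡ (toℕ (p mod n)) d 0 (trans (sym s) (trans (cong toℕ (sym e)) (sym (+-identityʳ _))))
  ... | inj₂ s = <⇒≢ q<p+n (cong (p +_) (sym n≡d))
    where
    n≡d : n ≡ d
    n≡d = +-cancelˡ-≡ (toℕ (p mod n)) n d (trans (cong (λ v → toℕ v + n) e) s)

  CNᶜ : Fin n → Fin n → Set
  CNᶜ = CN (CAdj n m)

  CAdj-sym : ∀ {u v} → CAdj n m u v → CAdj n m v u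
  CAdj-sym (k , 1≤k , k≤m , s) = k , 1≤k , k≤m , swap s

  CNᶜ-sym : ∀ {u v} → CNᶜ u v → CNᶜ v u
  CNᶜ-sym (inj₁ e) = inj₁ (sym e)
  CNᶜ-sym (inj₂ a) = inj₂ (CAdj-sym a)

  Step? : ∀ u v k → Dec (Step n u v k)
  Step? u v k = (toℕ v ≟ toℕ u + k) ⊎-dec (toℕ v + n ≟ toℕ u + k)

  CAdj? : ∀ u v → Dec (CAdj n m u v)
  CAdj? u v = map′ (λ { (k , s≤s k≤m , 1≤k , s) → k , 1≤k , k≤m , s })
                   (λ { (k , 1≤k , k≤m , s) → k , s≤s k≤m , 1≤k , s })
                   (anyUpTo? (λ k → (1 ≤? k) ×-dec (Step? u v k ⊎-dec Step? v u k)) (suc m))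

  CNᶜ? : ∀ u v → Dec (CNᶜ u v)
  CNᶜ? u v = (v Fin.≟ u) ⊎-dec CAdj? u v

  -- A length of at most `m` along either arc would witness adjacency; the second bound is for the
  -- arc that wraps past `n`.
  ¬CAdj⇒far : ∀ {a b : Fin n} → toℕ a < toℕ b → ¬ CAdj n m a b →
              toℕ a + m < toℕ b × toℕ b + m < toℕ a + n
  ¬CAdj⇒far {a} {b} a<b ¬ab = ≰⇒> p , ≰⇒> q
    where
    p : ¬ toℕ b ≤ toℕ a + m
    p h with m≤n⇒∃[o]m+o≡n (<⇒≤ a<b)
    ... | k , e = ¬ab (k , +-cancelˡ-≤ (toℕ a) 1 k (≤-trans (≤-reflexive (+-comm _ 1)) (subst (toℕ a <_) (sym e) a<b))
                         , +-cancelˡ-≤ (toℕ a) k m (subst (_≤ toℕ a + m) (sym e) h)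
                         , inj₁ (inj₁ (sym e)))
    q : ¬ toℕ a + n ≤ toℕ b + m
    q h with m≤n⇒∃[o]m+o≡n (≤-trans (<⇒≤ (toℕ<n b)) (m≤n+m n (toℕ a)))
    ... | k , e = ¬ab (k , +-cancelˡ-≤ (toℕ b) 1 k (≤-trans (≤-reflexive (+-comm _ 1))
                                (subst (toℕ b <_) (sym e) (≤-trans (toℕ<n b) (m≤n+m n (toℕ a)))))
                         , +-cancelˡ-≤ (toℕ b) k m (subst (_≤ toℕ b + m) (sym e) h)
                         , inj₂ (inj₂ (sym e)))

  module _ (m<n : m < n) where

    CAdj-irr : ∀ {v} → ¬ CAdj n m v v
    CAdj-irr {v} (k , 1≤k , k≤m , s) = [ go , go ]′ s
      where
      go : ¬ Step n v v k
      go (inj₁ e) = <⇒≢ 1≤k (sym (+-cancelˡ-≡ (toℕ v) k 0 (trans (sym e) (sym (+-identityʳ _)))))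
      go (inj₂ e) = <⇒≢ (≤-<-trans k≤m m<n) (sym (+-cancelˡ-≡ (toℕ v) n k e))

    near : ∀ {p q} → p ≤ q → q ≤ p + m → CNᶜ (p mod n) (q mod n)
    near {p} p≤q q≤p+m with m≤n⇒∃[o]m+o≡n p≤q
    ... | zero , refl = inj₁ (cong (_mod n) (+-identityʳ p))
    ... | suc k , refl = inj₂ (suc k , s≤s z≤n , k≤m , inj₁ (mod-step p (suc k) (≤-<-trans k≤m m<n)))
      where
      k≤m : suc k ≤ m
      k≤m = +-cancelˡ-≤ p _ _ q≤p+m

    -- Equality, or a step in either direction, would give congruent integers that are distinct and
    -- less than `n` apart.
    far : ∀ {p q} → p + m < q → q + m < p + n → ¬ CNᶜ (p mod n) (q mod n)
    far {p} {q} h₁ h₂ (inj₁ e) =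
      mod-≢ (≤-<-trans (m≤m+n p m) h₁) (≤-<-trans (m≤m+n q m) h₂) (sym e)
    far {p} {q} h₁ h₂ (inj₂ (k , _ , k≤m , inj₁ s)) =
      mod-≢ (≤-<-trans (+-monoʳ-≤ p k≤m) h₁)
            (<-≤-trans (≤-<-trans (m≤m+n q m) h₂) (+-monoˡ-≤ n (m≤m+n p k)))
            (step-mod s refl)
    far {p} {q} h₁ h₂ (inj₂ (k , _ , k≤m , inj₂ s)) =
      mod-≢ (≤-<-trans (+-monoʳ-≤ q k≤m) h₂)
            (+-monoˡ-< n (<-≤-trans (≤-<-trans (m≤m+n p m) h₁) (m≤m+n q k)))
            (trans (step-mod s refl) (sym ([p+n]-mod p)))

    -- Lets a footprint be handled as an integer next to a chosen position of the vertex. `m ≤ t`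
    -- keeps `t ∸ k` from truncating.
    lift-near : ∀ {v w t} → CNᶜ v w → t mod n ≡ v → m ≤ t →
                ∃ λ s → s mod n ≡ w × s ≤ t + m × t ≤ s + m
    lift-near {t = t} (inj₁ refl) e _ = t , e , m≤m+n t m , m≤m+n t m
    lift-near {t = t} (inj₂ (k , _ , k≤m , inj₁ s)) e _ =
      t + k , step-mod s e , +-monoʳ-≤ t k≤m , ≤-trans (m≤m+n t k) (m≤m+n (t + k) m)
    lift-near {w = w} {t} (inj₂ (k , _ , k≤m , inj₂ s)) e m≤t =
      t ∸ k , trans c (toℕ-mod-id w) , ≤-trans (m∸n≤m t k) (m≤m+n t m) ,
      ≤-trans (≤-reflexive (sym t-k+k)) (+-monoʳ-≤ (t ∸ k) k≤m)
      where
      t-k+k : t ∸ k + k ≡ t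
      t-k+k = m∸n+n≡m (≤-trans k≤m m≤t)
      c : (t ∸ k) mod n ≡ toℕ w mod n
      c = +-cancel-mod k (<⇒≤ (≤-<-trans k≤m m<n))
            (trans (cong (_mod n) t-k+k) (trans e (sym (step-mod s (toℕ-mod-id w)))))

-- Legal sequences of an arbitrary graph and the Grundy number as a bound on them.

¬¬-Π : ∀ {n} {P : Fin n → Set} → (∀ i → ¬ ¬ P i) → ¬ ¬ (∀ i → P i)
¬¬-Π {zero}  f k = k (λ ())
¬¬-Π {suc n} f k = f Fin.zero λ p₀ → ¬¬-Π (f ∘ Fin.suc) λ ps →
  k λ { Fin.zero → p₀ ; (Fin.suc i) → ps i }

module _ {V : Set} (Adj : V → V → Set) where

  private
    _~_ : V → V → Set
    _~_ = CN Adj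

  -- A legal sequence in reverse order (latest vertex first), each vertex paired with one it footprints.
  data Annotated : List (V × V) → Set where
    []  : Annotated []
    add : ∀ {v w E} → v ~ w → All (λ e → ¬ proj₁ e ~ w) E → Annotated E → Annotated ((v , w) ∷ E)

  -- The last hypothesis is the invariant: what `pre` leaves undominated, `E` leaves undominated
  -- too, so the footprints of `S` can be reused.
  annotate : ∀ pre S {E} → Footprints Adj pre S → Annotated E →
             (∀ w → All (λ u → ¬ u ~ w) pre → All (λ e → ¬ proj₁ e ~ w) E) →
             ∃ λ E′ → Annotated E′ × length E′ ≡ length E + length S
  annotate pre [] {E} _ a _ = E , a , sym (+-identityʳ _)
  annotate pre (v ∷ S) {E} ((w , v~w , new) , fp) a h
    with annotate (pre ∷ʳ v) S fp (add v~w (h w new) a)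
           (λ w′ al → All.head (Allₚ.++⁻ʳ pre al) ∷ h w′ (Allₚ.++⁻ˡ pre al))
  ... | E′ , a′ , e = E′ , a′ , trans e (sym (+-suc (length E) (length S)))

  Footprints-++ : ∀ {pre} S {S′} → Footprints Adj pre S → Footprints Adj (pre ++ S) S′ →
                  Footprints Adj pre (S ++ S′)
  Footprints-++ {pre} [] {S′} _ fp′ = subst (λ p → Footprints Adj p S′) (++-identityʳ pre) fp′
  Footprints-++ {pre} (v ∷ S) {S′} (new , fp) fp′ =
    new , Footprints-++ S fp (subst (λ p → Footprints Adj p S′) (sym (++-assoc pre [ v ] S)) fp′)

  -- An earlier copy of `v` would already dominate the vertex `w` that `v` footprints.
  Footprints⇒Unique : ∀ pre S → Footprints Adj pre S →
                      Unique S × All (λ v → All (λ u → u ≢ v) pre) S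
  Footprints⇒Unique pre [] _ = [] , []
  Footprints⇒Unique pre (v ∷ S) ((w , v~w , new) , fp) with Footprints⇒Unique (pre ∷ʳ v) S fp
  ... | uniq , al = All.map (λ p → All.head (Allₚ.++⁻ʳ pre p)) al ∷ uniq
                  , All.map (λ ¬u~w u≡v → ¬u~w (subst (_~ w) (sym u≡v) v~w)) new
                    ∷ All.map (Allₚ.++⁻ˡ pre) al

  forget : List (V × V) → List V
  forget E = reverse (map proj₁ E)

  All-reverse : ∀ {P : V → Set} xs → All P xs → All P (reverse xs)
  All-reverse [] [] = []
  All-reverse {P} (x ∷ xs) (p ∷ ps) = subst (All P) (sym (unfold-reverse x xs)) (Allₚ.∷ʳ⁺ (All-reverse xs ps) p)

  forget-footprints : ∀ {E} → Annotated E → Footprints Adj [] (forget E)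
  forget-footprints [] = tt
  forget-footprints {(v , w) ∷ E} (add v~w new a) =
    subst (Footprints Adj []) (sym (unfold-reverse v (map proj₁ E)))
      (Footprints-++ (forget E) (forget-footprints a)
        ((w , v~w , All-reverse _ (Allₚ.map⁺ new)) , tt))

module _ (N : ℕ) (Adj : Fin N → Fin N → Set) where

  private
    _~_ : Fin N → Fin N → Set
    _~_ = CN Adj

    Dominated : List (Fin N × Fin N) → Fin N → Set
    Dominated E y = Any (λ e → proj₁ e ~ y) E

  module _ (_~?_ : ∀ x y → Dec (x ~ y)) where

    -- An undominated vertex can always be added, footprinting itself. Hence the Grundy number also
    -- bounds legal sequences that do not dominate.
    dominating-extension : ∀ ys {E} → Annotated Adj E →
      ∃ λ E′ → Annotated Adj E′ × length E ≤ length E′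
             × (∀ {y} → Dominated E y → Dominated E′ y) × All (Dominated E′) ys
    dominating-extension [] {E} a = E , a , ≤-refl , id , []
    dominating-extension (y ∷ ys) {E} a with any? (λ e → proj₁ e ~? y) E
    ... | yes d with dominating-extension ys a
    ...   | E′ , a′ , le , mono , al = E′ , a′ , le , mono , mono d ∷ al
    dominating-extension (y ∷ ys) {E} a | no ¬d
      with dominating-extension ys (add (inj₁ refl) (Allₚ.¬Any⇒All¬ E ¬d) a)
    ... | E′ , a′ , le , mono , al =
      E′ , a′ , ≤-trans (n≤1+n _) le , mono ∘ there , mono (here (inj₁ refl)) ∷ al

    annotated-≤-dec : ∀ {k} → GrundyNumber Adj k → ∀ {E} → Annotated Adj E → length E ≤ k
    annotated-≤-dec (_ , max) a with dominating-extension (allFin N) a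
    ... | E′ , a′ , le , _ , al = ≤-trans le (subst (_≤ _)
      (trans (length-reverse (map proj₁ E′)) (length-map proj₁ E′))
      (max (forget Adj E′)
        ( proj₁ (Footprints⇒Unique Adj [] _ (forget-footprints Adj a′))
        , forget-footprints Adj a′
        , λ w → Anyₚ.reverse⁺ (Anyₚ.map⁺ (All.lookup al (∈-allFin w))))))

  -- Adjacency may be undecidable, but the conclusion is ¬¬-stable.
  annotated-≤ : ∀ {k} → GrundyNumber Adj k → ∀ {E} → Annotated Adj E → length E ≤ k
  annotated-≤ gn {E} a = decidable-stable (length E ≤? _) λ ¬le →
    ¬¬-Π {P = λ x → ∀ y → Dec (x ~ y)} (λ x → ¬¬-Π (λ y → ¬¬-excluded-middle))
      (λ d → ¬le (annotated-≤-dec d gn a))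

-- Indicators and sums over intervals of integers.

indicator : ∀ {P : Set} → Dec P → ℕ
indicator d = if does d then 1 else 0

indicator-yes : ∀ {P : Set} (d : Dec P) → P → indicator d ≡ 1
indicator-yes (yes _) _ = refl
indicator-yes (no ¬p) p = contradiction p ¬p

indicator-¬? : ∀ {P : Set} (d : Dec P) → indicator d + indicator (¬? d) ≡ 1
indicator-¬? (yes _) = refl
indicator-¬? (no _)  = refl

interchange : ∀ a b c d → a + b + (c + d) ≡ a + c + (b + d)
interchange a b c d = solve (a & b & c & d & ∙)

∑ : (ℕ → ℕ) → ℕ → ℕ → ℕ
∑ f lo zero    = 0
∑ f lo (suc k) = f lo + ∑ f (suc lo) k

∑-split : ∀ f lo k l → ∑ f lo (k + l) ≡ ∑ f lo k + ∑ f (lo + k) l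
∑-split f lo zero l = cong (λ x → ∑ f x l) (sym (+-identityʳ lo))
∑-split f lo (suc k) l = trans (cong (f lo +_) (trans (∑-split f (suc lo) k l)
  (cong (λ x → ∑ f (suc lo) k + ∑ f x l) (sym (+-suc lo k))))) (sym (+-assoc (f lo) _ _))

∑-mono : ∀ {f g} → (∀ t → f t ≤ g t) → ∀ lo k → ∑ f lo k ≤ ∑ g lo k
∑-mono h lo zero    = z≤n
∑-mono h lo (suc k) = +-mono-≤ (h lo) (∑-mono h (suc lo) k)

∑-+ : ∀ f g lo k → ∑ (λ t → f t + g t) lo k ≡ ∑ f lo k + ∑ g lo k
∑-+ f g lo zero    = refl
∑-+ f g lo (suc k) = trans (cong (f lo + g lo +_) (∑-+ f g (suc lo) k)) (interchange (f lo) (g lo) _ _)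

∑-one : ∀ {f} lo k → (∀ t → lo ≤ t → t < lo + k → f t ≡ 1) → ∑ f lo k ≡ k
∑-one lo zero h = refl
∑-one lo (suc k) h = cong₂ _+_ (h lo ≤-refl (m<m+n lo z<s))
  (∑-one (suc lo) k (λ t p q → h t (<⇒≤ p) (subst (t <_) (sym (+-suc lo k)) q)))

-- The window is cut into `p` terms before the run of ones, the `k` ones, and `q` terms after it.
∑-≥ : ∀ f {a d lo k} → a ≤ lo → lo + k ≤ a + d → (∀ t → lo ≤ t → t < lo + k → f t ≡ 1) → k ≤ ∑ f a d
∑-≥ f {a} {d} {lo} {k} a≤lo lo+k≤a+d h with m≤n⇒∃[o]m+o≡n a≤lo
... | p , refl with m≤n⇒∃[o]m+o≡n (+-cancelˡ-≤ a (p + k) d (subst (_≤ a + d) (+-assoc a p k) lo+k≤a+d))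
... | q , refl = begin
  k                                             ≡⟨ ∑-one (a + p) k h ⟨
  ∑ f (a + p) k                                 ≤⟨ m≤n+m _ _ ⟩
  ∑ f a p + ∑ f (a + p) k                       ≡⟨ ∑-split f a p k ⟨
  ∑ f a (p + k)                                 ≤⟨ m≤m+n _ _ ⟩
  ∑ f a (p + k) + ∑ f (a + (p + k)) q           ≡⟨ ∑-split f a (p + k) q ⟨
  ∑ f a (p + k + q)                             ∎
  where open ≤-Reasoning

-- Counting unvisited positions for legal sequences of the cycle power.

module Counting (n m : ℕ) .{{_ : NonZero n}} (2m+2≤n : 2 * (m + 1) ≤ n) where

  open Cyclic n m public

  m+m<n : m + m < n
  m+m<n = lin 2m+2≤n 1 (solve (m & n & ∙))

  m<n : m < n
  m<n = ≤-<-trans (m≤m+n m m) m+m<n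

  Pairs : Set
  Pairs = List (Fin n × Fin n)

  Annotatedᶜ : Pairs → Set
  Annotatedᶜ = Annotated (CAdj n m)

  Undominated : Fin n → Pairs → Set
  Undominated w T = All (λ e → ¬ CNᶜ (proj₁ e) w) T

  Used : Pairs → ℕ → Set
  Used T t = Any (λ e → t mod n ≡ proj₁ e) T

  used? : ∀ T t → Dec (Used T t)
  used? T t = any? (λ e → t mod n Fin.≟ proj₁ e) T

  -- The self-footprinting vertices, which become the independent set `I`.
  Diag : Pairs → Fin n → Set
  Diag T a = (a , a) ∈ T

  undominated⇒unused : ∀ {w T t} → Undominated w T → CNᶜ (t mod n) w → ¬ Used T t
  undominated⇒unused (¬c ∷ _) c (here e)  = ¬c (subst (λ u → CNᶜ u _) e c)
  undominated⇒unused (_ ∷ al) c (there i) = undominated⇒unused al c i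

  undominated⇒∉ : ∀ {w T u u′} → Undominated w T → CNᶜ u w → ¬ (u , u′) ∈ T
  undominated⇒∉ al c i = All.lookup al i c

  -- If they were adjacent, the earlier of the two would dominate the later one, which could then
  -- not footprint itself.
  diag-independent : ∀ {T a b} → Annotatedᶜ T → Diag T a → Diag T b → a ≢ b → ¬ CAdj n m a b
  diag-independent (add _ new _) (here refl) (here refl) a≢b _ = a≢b refl
  diag-independent (add _ new _) (here refl) (there j) _ ab = undominated⇒∉ new (inj₂ (CAdj-sym ab)) j
  diag-independent (add _ new _) (there i) (here refl) _ ab = undominated⇒∉ new (inj₂ ab) i
  diag-independent (add _ _ A) (there i) (there j) a≢b ab = diag-independent A i j a≢b ab

  -- The window starts at `toℕ a + n` so that all its positions are at least `n`, hence above `m`,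
  -- and subtracting up to `m` is exact.
  lift-in-window : ∀ (a v : Fin n) → ∃ λ t → toℕ a + n ≤ t × t < toℕ a + n + n × t mod n ≡ v
  lift-in-window a v with toℕ a ≤? toℕ v
  ... | yes le = toℕ v + n , +-monoˡ-≤ n le
               , <-≤-trans (+-monoˡ-< n (toℕ<n v)) (+-monoˡ-≤ n (m≤n+m n (toℕ a)))
               , trans ([p+n]-mod (toℕ v)) (toℕ-mod-id v)
  ... | no ≰ = toℕ v + n + n , ≤-trans (+-monoˡ-≤ n (<⇒≤ (toℕ<n a))) (+-monoˡ-≤ n (m≤n+m n (toℕ v)))
             , +-monoˡ-< n (+-monoˡ-< n (≰⇒> ≰))
             , trans ([p+n]-mod (toℕ v + n)) (trans ([p+n]-mod (toℕ v)) (toℕ-mod-id v))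

  length≤used : ∀ a {T} → Annotatedᶜ T → length T ≤ ∑ (λ t → indicator (used? T t)) (toℕ a + n) n
  length≤used a [] = z≤n
  length≤used a {(v , w) ∷ T} (add v~w new A) = begin
    1 + length T                                ≤⟨ +-mono-≤ hit (length≤used a A) ⟩
    ∑ δ lo n + ∑ (λ t → indicator (used? T t)) lo n ≡⟨ ∑-+ δ _ lo n ⟨
    ∑ (λ t → δ t + indicator (used? T t)) lo n      ≤⟨ ∑-mono pointwise lo n ⟩
    ∑ (λ t → indicator (used? ((v , w) ∷ T) t)) lo n ∎
    where
    open ≤-Reasoning
    lo = toℕ a + n
    δ : ℕ → ℕ
    δ t = indicator (t mod n Fin.≟ v)
    hit : 1 ≤ ∑ δ lo n
    hit with lift-in-window a v
    ... | t , lo≤t , t<hi , e = ∑-≥ δ lo≤t (subst (_≤ lo + n) (+-comm 1 t) t<hi)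
      λ s t≤s s<t+1 → indicator-yes (s mod n Fin.≟ v) (subst (λ x → x mod n ≡ v)
        (≤-antisym t≤s (≤-pred (subst (s <_) (+-comm t 1) s<t+1))) e)
    pointwise : ∀ t → δ t + indicator (used? T t) ≤ indicator (used? ((v , w) ∷ T) t)
    pointwise t with t mod n Fin.≟ v | used? T t
    ... | yes e | yes u = contradiction u (undominated⇒unused new (subst (λ x → CNᶜ x w) (sym e) v~w))
    ... | yes _ | no _  = ≤-refl
    ... | no _  | yes _ = ≤-refl
    ... | no _  | no _  = z≤n

  -- The run `start`, ..., `start + m - 1` lies strictly between `a` and `b`, so the holes of
  -- successive arcs are disjoint.
  record Hole (T : Pairs) (a b : ℕ) : Set where
    constructor hole
    field
      start  : ℕ
      after  : a < start
      before : start + m ≤ b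
      unused : ∀ t → start ≤ t → t < start + m → ¬ Used T t

  unused-∷ : ∀ {v w T t} → t mod n ≢ v → ¬ Used T t → ¬ Used ((v , w) ∷ T) t
  unused-∷ ≢ ¬u (here e)  = ≢ e
  unused-∷ ≢ ¬u (there u) = ¬u u

  in-interval? : ∀ (v : Fin n) a b → Dec (∃ λ t → a ≤ t × t ≤ b × t mod n ≡ v)
  in-interval? v a b = map′ (λ { (t , s≤s t≤b , a≤t , e) → t , a≤t , t≤b , e })
                            (λ { (t , a≤t , t≤b , e) → t , s≤s t≤b , a≤t , e })
                            (anyUpTo? (λ t → (a ≤? t) ×-dec (t mod n Fin.≟ v)) (suc b))

  -- The hole lies around the vertex footprinted by the latest vertex of the sequence in the arc [a , b].
  gap-hole : ∀ {T} → Annotatedᶜ T → ∀ {a b} → m ≤ a → a + m < b → b ≤ a + n →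
             Diag T (a mod n) → Diag T (b mod n) → Hole T a b
  gap-hole {(v , w) ∷ T} (add v~w new A) {a} {b} m≤a a+m<b b≤a+n i j with in-interval? v a b
  -- The latest vertex has no position in the arc, so neither end is that vertex and the earlier
  -- hole survives.
  ... | no ∉gap with i | j
  ...   | here refl | _ = contradiction (a , ≤-refl , ≤-trans (m≤m+n a m) (<⇒≤ a+m<b) , refl) ∉gap
  ...   | there _ | here refl = contradiction (b , ≤-trans (m≤m+n a m) (<⇒≤ a+m<b) , ≤-refl , refl) ∉gap
  ...   | there i′ | there j′ with gap-hole A m≤a a+m<b b≤a+n i′ j′
  ...     | hole lo a<lo lo+m≤b un = hole lo a<lo lo+m≤b λ t p q →
            unused-∷ (λ e → ∉gap (t , ≤-trans (<⇒≤ a<lo) p , <⇒≤ (<-≤-trans q lo+m≤b) , e)) (un t p q)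
  gap-hole {(v , w) ∷ T} (add v~w new A) {a} {b} m≤a a+m<b b≤a+n i j | yes (t , a≤t , t≤b , refl)
    with i | j
  -- The latest vertex is `a`, footprinting itself: nothing earlier is in its closed neighbourhood,
  -- so the next `m` positions are free.
  ... | here e | _ = hole (suc a) ≤-refl a+m<b λ s a<s s<a+m →
        unused-∷ (λ e′ → mod-≢ a<s (<-trans s<a+m (s<a+n s)) (trans (cong proj₁ e) (sym e′)))
                 (undominated⇒unused new (subst (CNᶜ (s mod n)) (cong proj₂ e)
                   (CNᶜ-sym (near m<n (<⇒≤ a<s) (≤-pred s<a+m)))))
    where
    s<a+n : ∀ s → suc a + m < a + n
    s<a+n s = lin 2m+2≤n m (solve (a & m & n & ∙))
  -- The mirror case: the latest vertex is `b`, and the `m` positions before it are free.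
  ... | there _ | here e = hole (b ∸ m) (+-cancelʳ-< m a (b ∸ m) (subst (a + m <_) (sym b-m+m) a+m<b))
        (≤-reflexive b-m+m) λ s p q →
        unused-∷ (λ e′ → mod-≢ (s<b q) (≤-<-trans (b≤s+m p) (+-monoʳ-< s m<n)) (trans e′ (sym (cong proj₁ e))))
                 (undominated⇒unused new (subst (CNᶜ (s mod n)) (cong proj₂ e)
                   (near m<n (<⇒≤ (s<b q)) (b≤s+m p))))
    where
    b-m+m : b ∸ m + m ≡ b
    b-m+m = m∸n+n≡m (≤-trans (m≤n+m m a) (<⇒≤ a+m<b))
    s<b : ∀ {s} → s < b ∸ m + m → s < b
    s<b {s} = subst (s <_) b-m+m
    b≤s+m : ∀ {s} → b ∸ m ≤ s → b ≤ s + m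
    b≤s+m p = subst (_≤ _) b-m+m (+-monoˡ-≤ m p)
  ... | there i′ | there j′ with lift-near m<n v~w refl (≤-trans m≤a a≤t)
  ...   | s , refl , s≤t+m , t≤s+m = go (s ≤? t)
    where
    -- Both ends were visited while `w` was undominated, so the position `s` of `w` is more than `m`
    -- from each, and the `m` positions on either side of it fit in the arc.
    a≁w : ¬ CNᶜ (a mod n) (s mod n)
    a≁w c = undominated⇒∉ new c i′
    b≁w : ¬ CNᶜ (b mod n) (s mod n)
    b≁w c = undominated⇒∉ new c j′
    a+m<s : a + m < s
    a+m<s with s ≤? a + m | s ≤? a
    ... | no ≰ | _ = ≰⇒> ≰
    ... | yes le | yes s≤a = contradiction (CNᶜ-sym (near m<n s≤a (≤-trans a≤t t≤s+m))) a≁w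
    ... | yes le | no ≰ = contradiction (near m<n (<⇒≤ (≰⇒> ≰)) le) a≁w
    s+m<b : s + m < b
    s+m<b with b ≤? s + m | b ≤? s
    ... | no ≰ | _ = ≰⇒> ≰
    ... | yes le | yes b≤s = contradiction (near m<n b≤s (≤-trans s≤t+m (+-monoˡ-≤ m t≤b))) b≁w
    ... | yes le | no ≰ = contradiction (CNᶜ-sym (near m<n (<⇒≤ (≰⇒> ≰)) le)) b≁w
    -- The hole is taken on the side of `s` away from `t`, which keeps it clear of the latest
    -- vertex.
    go : Dec (s ≤ t) → Hole ((t mod n , s mod n) ∷ T) a b
    go (yes s≤t) = hole (s ∸ m) (+-cancelʳ-< m a (s ∸ m) (subst (a + m <_) (sym s-m+m) a+m<s))
      (≤-trans (≤-reflexive s-m+m) (≤-trans (m≤m+n s m) (<⇒≤ s+m<b)))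
      λ r p q → unused-∷
        (mod-≢ (<-≤-trans (subst (r <_) s-m+m q) s≤t)
               (≤-<-trans t≤s+m (≤-<-trans (+-monoˡ-≤ m (s≤r+m p))
                 (subst (_< r + n) (sym (+-assoc r m m)) (+-monoʳ-< r m+m<n)))))
        (undominated⇒unused new (near m<n (<⇒≤ (subst (r <_) s-m+m q)) (s≤r+m p)))
      where
      s-m+m : s ∸ m + m ≡ s
      s-m+m = m∸n+n≡m (≤-trans (m≤n+m m a) (<⇒≤ a+m<s))
      s≤r+m : ∀ {r} → s ∸ m ≤ r → s ≤ r + m
      s≤r+m p = subst (_≤ _) s-m+m (+-monoˡ-≤ m p)
    go (no s≰t) = hole (suc s) (s≤s (≤-trans (m≤m+n a m) (<⇒≤ a+m<s))) s+m<b
      λ r p q → unused-∷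
        (λ e → mod-≢ (<-trans (≰⇒> s≰t) p) (r<t+n r q) (sym e))
        (undominated⇒unused new (CNᶜ-sym (near m<n (<⇒≤ p) (≤-pred q))))
      where
      r<t+n : ∀ r → r < suc s + m → r < t + n
      r<t+n r q = lin (q ⊕ s≤t+m ⊕ m+m<n) 0 (solve (r & s & t & m & n & ∙))

  free : Pairs → ℕ → ℕ
  free T t = indicator (¬? (used? T t))

  gap-free : ∀ {T} → Annotatedᶜ T → ∀ {a b d} → m ≤ a → a + m < b → b ≤ a + n → a + d ≡ b →
             Diag T (a mod n) → Diag T (b mod n) → m ≤ ∑ (free T) a d
  gap-free {T} A m≤a h₁ h₂ refl i j with gap-hole A m≤a h₁ h₂ i j
  ... | hole lo a<lo lo+m≤b un = ∑-≥ (free T) (<⇒≤ a<lo) lo+m≤b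
    (λ t p q → indicator-yes (¬? (used? T t)) (un t p q))

  module _ {T : Pairs} (A : Annotatedᶜ T) where

    diag-mod : ∀ {a : Fin n} → Diag T a → Diag T ((toℕ a + n) mod n)
    diag-mod {a} = subst (Diag T) (sym (trans ([p+n]-mod (toℕ a)) (toℕ-mod-id a)))

    -- Each arc between successive elements contributes `m` free positions; the last arc closes up
    -- at `a₀` one turn later, and `d` is the total length of the arcs.
    chain-free : ∀ (a₀ a : Fin n) I → AllPairs (λ x y → toℕ x < toℕ y) (a ∷ I) →
                 AllPairs (λ x y → ¬ CAdj n m x y) (a ∷ I) →
                 toℕ a₀ ≤ toℕ a → All (λ x → toℕ x + m < toℕ a₀ + n) (a ∷ I) →
                 All (Diag T) (a₀ ∷ a ∷ I) →
                 ∃ λ d → toℕ a + n + d ≡ toℕ a₀ + n + n × length (a ∷ I) * m ≤ ∑ (free T) (toℕ a + n) d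
    chain-free a₀ a [] _ _ a₀≤a (h ∷ []) (d₀ ∷ da ∷ [])
      with m≤n⇒∃[o]m+o≡n (+-monoˡ-≤ n (≤-trans (m≤m+n (toℕ a) m) (<⇒≤ h)))
    ... | d , e = d , e , ≤-trans (≤-reflexive (+-identityʳ m))
      (gap-free A (≤-trans (<⇒≤ m<n) (m≤n+m n _))
        (subst (_< toℕ a₀ + n + n) (shift (toℕ a) m n) (+-monoˡ-< n h))
        (+-monoˡ-≤ n (+-monoˡ-≤ n a₀≤a)) e (diag-mod da)
        (subst (Diag T) (sym ([p+n]-mod (toℕ a₀ + n))) (diag-mod d₀)))
      where
      shift : ∀ x y z → x + y + z ≡ x + z + y
      shift x y z = solve (x & y & z & ∙)
    chain-free a₀ a (b ∷ I) (a<all ∷ sorted) (¬adj ∷ indep) a₀≤a (_ ∷ hs) (d₀ ∷ da ∷ ds)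
      with ¬CAdj⇒far (All.head a<all) (All.head ¬adj)
         | chain-free a₀ b I sorted indep (≤-trans a₀≤a (<⇒≤ (All.head a<all))) hs (d₀ ∷ ds)
         | m≤n⇒∃[o]m+o≡n (<⇒≤ (All.head a<all))
    ... | h₁ , h₂ | d , e , le | d′ , e′ = d′ + d , eq (toℕ a) (toℕ b) n e′ e , (begin
      m + length (b ∷ I) * m              ≤⟨ +-mono-≤ first le ⟩
      ∑ (free T) (toℕ a + n) d′ + ∑ (free T) (toℕ b + n) d
        ≡⟨ cong (λ x → ∑ (free T) (toℕ a + n) d′ + ∑ (free T) x d) (sym a+n+d′) ⟩
      ∑ (free T) (toℕ a + n) d′ + ∑ (free T) (toℕ a + n + d′) d ≡⟨ ∑-split (free T) (toℕ a + n) d′ d ⟨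
      ∑ (free T) (toℕ a + n) (d′ + d)     ∎)
      where
      open ≤-Reasoning
      shift : ∀ x y z → x + y + z ≡ x + z + y
      shift x y z = solve (x & y & z & ∙)
      a+n+d′ : toℕ a + n + d′ ≡ toℕ b + n
      a+n+d′ = trans (shift (toℕ a) n d′) (cong (_+ n) e′)
      eq : ∀ x y z {r} → x + d′ ≡ y → y + z + d ≡ r → x + z + (d′ + d) ≡ r
      eq x y z refl refl = solve (x & z & d′ & d & ∙)
      first : m ≤ ∑ (free T) (toℕ a + n) d′
      first = gap-free A (≤-trans (<⇒≤ m<n) (m≤n+m n _))
        (subst (_< toℕ b + n) (shift (toℕ a) m n) (+-monoˡ-< n h₁))
        (+-monoˡ-≤ n (≤-trans (m≤m+n (toℕ b) m) (<⇒≤ h₂))) a+n+d′ (diag-mod da) (diag-mod (All.head ds))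

    -- Taking `a₀` to be `a`, the arcs make one full turn, in which every position is either used or
    -- free.
    length-bound : ∀ I → IsI2 n m I → All (Diag T) I → length T + length I * m ≤ n
    length-bound (a ∷ I@(_ ∷ _)) (sorted@(a<all ∷ _) , indep@(¬adj ∷ _) , _) ds@(da ∷ _)
      with chain-free a a I sorted indep ≤-refl
             (+-monoʳ-< (toℕ a) m<n ∷ All.zipWith (λ { (lt , ¬ab) → proj₂ (¬CAdj⇒far lt ¬ab) }) (a<all , ¬adj))
             (da ∷ ds)
    ... | d , e , le with +-cancelˡ-≡ (toℕ a + n) d n e
    ... | refl = begin
      length T + length (a ∷ I) * m   ≤⟨ +-mono-≤ (length≤used a A) le ⟩
      ∑ used (toℕ a + n) n + ∑ (free T) (toℕ a + n) n ≡⟨ ∑-+ used (free T) (toℕ a + n) n ⟨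
      ∑ (λ t → used t + free T t) (toℕ a + n) n ≡⟨ ∑-one (toℕ a + n) n (λ t _ _ → indicator-¬? (used? T t)) ⟩
      n ∎
      where
      open ≤-Reasoning
      used : ℕ → ℕ
      used t = indicator (used? T t)
    length-bound [] (_ , _ , ())
    length-bound (_ ∷ []) (_ , _ , s≤s ())

-- The upper bound for legal sequences of the join.

module _ {A : Set} where

  sum-map-+ : ∀ (f g : A → ℕ) xs → sum (map (λ x → f x + g x) xs) ≡ sum (map f xs) + sum (map g xs)
  sum-map-+ f g [] = refl
  sum-map-+ f g (x ∷ xs) = trans (cong (f x + g x +_) (sum-map-+ f g xs)) (interchange (f x) (g x) _ _)

  ∈⇒≤sum : ∀ (f : A → ℕ) {x xs} → x ∈ xs → f x ≤ sum (map f xs)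
  ∈⇒≤sum f {xs = _ ∷ xs} (here refl) = m≤m+n _ (sum (map f xs))
  ∈⇒≤sum f {xs = y ∷ _} (there i) = ≤-trans (∈⇒≤sum f i) (m≤n+m _ (f y))

  module _ {P : A → Set} (P? : ∀ x → Dec (P x)) (c g : A → ℕ)
           (c≡0 : ∀ x → c x ≡ 0 ⊎ P x) (c<g : ∀ x → P x → c x < g x) where

    -- Strictness of `c x < g x` pays for the unit that `x` adds to the length; outside `P` there is
    -- no charge at all.
    sum+length-filter≤ : ∀ xs → sum (map c xs) + length (filter P? xs) ≤ sum (map g (filter P? xs))
    sum+length-filter≤ [] = z≤n
    sum+length-filter≤ (x ∷ xs) with P? x
    ... | no ¬p with c≡0 x
    ...   | inj₁ e rewrite e = sum+length-filter≤ xs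
    ...   | inj₂ p = contradiction p ¬p
    sum+length-filter≤ (x ∷ xs) | yes p =
      step _ _ _ _ _ (c<g x p) (sum+length-filter≤ xs)
      where
      step : ∀ a b c d e → a < b → c + d ≤ e → a + c + suc d ≤ b + e
      step a b c d e h k = lin (h ⊕ k) 0 (solve (a & b & c & d & e & ∙))

distinct⇒2≤length : ∀ {A : Set} {a b : A} {xs} → a ∈ xs → b ∈ xs → a ≢ b → 2 ≤ length xs
distinct⇒2≤length {xs = _ ∷ []} (here refl) (here refl) a≢b = contradiction refl a≢b
distinct⇒2≤length {xs = _ ∷ _ ∷ _} _ _ _ = s≤s (s≤s z≤n)

AllPairs-zip : ∀ {A : Set} {P : A → Set} {Q S : A → A → Set} → (∀ {x y} → P x → P y → Q x y → S x y) →
               ∀ {xs} → All P xs → AllPairs Q xs → AllPairs S xs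
AllPairs-zip f [] [] = []
AllPairs-zip f (p ∷ ps) (qs ∷ qss) = All.zipWith (λ { (p′ , q) → f p p′ q }) (ps , qs) ∷ AllPairs-zip f ps qss

module Upper (n m : ℕ) .{{_ : NonZero n}} (2m+2≤n : 2 * (m + 1) ≤ n) (R : Fin n → FinGraph) where

  open Counting n m 2m+2≤n public

  V : Set
  V = JV n m R

  _~ᴶ_ : V → V → Set
  _~ᴶ_ = CN (JAdj n m R)

  G : (j : Fin n) → Fin (FinGraph.size (R j)) → Fin (FinGraph.size (R j)) → Set
  G j = FinGraph.Adj (R j)

  layer-CN : ∀ {u w : V} → u ~ᴶ w → CNᶜ (proj₁ u) (proj₁ w)
  layer-CN (inj₁ refl)      = inj₁ refl
  layer-CN (inj₂ (inner _)) = inj₁ refl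
  layer-CN (inj₂ (outer a)) = inj₂ a

  within-CN : ∀ {i x y} → (i , x) ~ᴶ (i , y) → CN (G i) x y
  within-CN (inj₁ refl)      = inj₁ refl
  within-CN (inj₂ (inner a)) = inj₂ a
  within-CN (inj₂ (outer a)) = contradiction a (CAdj-irr m<n)

  within-CN⁻ : ∀ {i x y} → CN (G i) x y → (i , x) ~ᴶ (i , y)
  within-CN⁻ (inj₁ refl) = inj₁ refl
  within-CN⁻ (inj₂ a)    = inj₂ (inner a)

  layer : V × V → Fin n
  layer e = proj₁ (proj₁ e)

  δ : Fin n → Fin n → ℕ
  δ i j = indicator (i Fin.≟ j)

  -- A closed neighbour of `k` was visited but no neighbour was, so it can only be `k` itself.
  revisit : ∀ {k E} → All (λ e → ¬ CAdj n m (layer e) k) E → ¬ All (λ e → ¬ CNᶜ (layer e) k) E →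
            Any (λ e → layer e ≡ k) E
  revisit {k} {E} ¬adj ¬fresh with any? (λ e → layer e Fin.≟ k) E
  ... | yes v = v
  ... | no ¬v = contradiction (All.zipWith (λ { (≢ , _) (inj₁ e) → ≢ (sym e) ; (_ , ¬a) (inj₂ a) → ¬a a })
                                           (Allₚ.¬Any⇒All¬ E ¬v , ¬adj)) ¬fresh

  sum-δ : ∀ j (f : Fin n → ℕ) → suc (sum (map f (allFin n))) ≤ sum (map (λ k → δ j k + f k) (allFin n))
  sum-δ j f = subst (suc (sum (map f (allFin n))) ≤_) (sym (sum-map-+ (δ j) f (allFin n)))
    (+-monoˡ-≤ (sum (map f (allFin n)))
      (≤-trans (≤-reflexive (sym (indicator-yes (j Fin.≟ j) refl))) (∈⇒≤sum (δ j) (∈-allFin j))))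

  -- E is split into a legal sequence T of the cycle power, and vertices charged to the layer of their
  -- footprint when that layer was already visited; charged j and d j count, for layer j, the charged
  -- vertices and the first visits with N[j] unvisited, which together yield a legal sequence Z of G_j.
  record Split (E : List (V × V)) : Set where
    field
      T           : Pairs
      charged d   : Fin n → ℕ
      annotated   : Annotatedᶜ T
      avoids      : ∀ w → All (λ e → ¬ CNᶜ (layer e) w) E → Undominated w T
      within      : ∀ j → ∃ λ Z → Annotated (G j) Z × length Z ≡ charged j + d j ×
                      (∀ y → All (λ e → ¬ proj₁ e ~ᴶ (j , y)) E → All (λ z → ¬ CN (G j) (proj₁ z) y) Z)
      charged-diag : ∀ j → charged j ≡ 0 ⊎ Diag T j
      diag-d      : ∀ j → Diag T j → 1 ≤ d j
      length≤     : length E ≤ sum (map charged (allFin n)) + length T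
      visited     : ∀ j → Any (λ e → layer e ≡ j) E → All (λ e → ¬ CAdj n m (layer e) j) E → Diag T j

  split : ∀ {E} → Annotated (JAdj n m R) E → Split E
  split [] = record
    { T = [] ; charged = λ _ → 0 ; d = λ _ → 0 ; annotated = [] ; avoids = λ _ _ → []
    ; within = λ j → [] , [] , refl , λ _ _ → []
    ; charged-diag = λ _ → inj₁ refl ; diag-d = λ _ () ; length≤ = z≤n ; visited = λ _ () }
  split {((i , x) , (j , y)) ∷ E} (add v~w new A) with split A
  ... | S with all? (λ e → ¬? (CNᶜ? (layer e) i)) E
  -- No closed neighbour of `i` was visited: `i` enters `T` footprinting itself, even if the
  -- original footprint is in another layer, and `x` joins the sequence of `G i`, also footprinting
  -- itself.
  ... | yes fresh = record
    { T = (i , i) ∷ T ; charged = charged ; d = λ k → δ i k + d k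
    ; annotated = add (inj₁ refl) (avoids i fresh) annotated
    ; avoids = λ { w (¬c ∷ al) → ¬c ∷ avoids w al }
    ; within = within′
    ; charged-diag = λ k → map₂ there (charged-diag k)
    ; diag-d = λ { k (here refl) → ≤-trans (≤-reflexive (sym (indicator-yes (i Fin.≟ i) refl))) (m≤m+n _ _)
                 ; k (there t) → ≤-trans (diag-d k t) (m≤n+m _ _) }
    ; length≤ = ≤-trans (s≤s length≤) (≤-reflexive (sym (+-suc _ _)))
    ; visited = λ { k (here refl) _ → here refl ; k (there v) (_ ∷ al) → there (visited k v al) }
    }
    where
    open Split S
    within′ : ∀ k → ∃ λ Z → Annotated (G k) Z × length Z ≡ charged k + (δ i k + d k) ×
              (∀ y′ → All (λ e → ¬ proj₁ e ~ᴶ (k , y′)) (((i , x) , (j , y)) ∷ E) → All (λ z → ¬ CN (G k) (proj₁ z) y′) Z)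
    within′ k with i Fin.≟ k | within k
    ... | no _ | Z , a , e , h = Z , a , e , λ { y′ (_ ∷ al) → h y′ al }
    ... | yes refl | Z , a , e , h =
      (x , x) ∷ Z , add (inj₁ refl) (h x (All.map (_∘ layer-CN) fresh)) a
      , trans (cong suc e) (sym (+-suc _ _))
      , λ { y′ (¬c ∷ al) → (¬c ∘ within-CN⁻) ∷ h y′ al }
  ... | no ¬fresh with any? (λ e → layer e Fin.≟ j) E
  -- Legality in the join excludes visited neighbours of `j`; as `j` is unvisited too, `i` can
  -- footprint it in `T`.
  ... | no unvisited = record
    { T = (i , j) ∷ T ; charged = charged ; d = d
    ; annotated = add i~j (avoids j j-fresh) annotated
    ; avoids = λ { w (¬c ∷ al) → ¬c ∷ avoids w al }
    ; within = λ k → let (Z , a , e , h) = within k in Z , a , e , λ { y′ (_ ∷ al) → h y′ al }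
    ; charged-diag = λ k → map₂ there (charged-diag k)
    ; diag-d = λ { k (here refl) → contradiction j-fresh ¬fresh ; k (there t) → diag-d k t }
    ; length≤ = ≤-trans (s≤s length≤) (≤-reflexive (sym (+-suc _ _)))
    ; visited = λ { k (here refl) (_ ∷ al) → there (visited k (revisit al ¬fresh) al)
                  ; k (there v) (_ ∷ al) → there (visited k v al) }
    }
    where
    open Split S
    i~j : CNᶜ i j
    i~j = layer-CN v~w
    j-fresh : All (λ e → ¬ CNᶜ (layer e) j) E
    j-fresh = All.zipWith (λ { (≢ , ¬c) (inj₁ e) → ≢ (sym e) ; (≢ , ¬c) (inj₂ a) → ¬c (inj₂ (outer a)) })
                          (Allₚ.¬Any⇒All¬ E unvisited , new)
  -- Here `j` was visited and its neighbours were not, so `j` is self-footprinting in `T` and can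
  -- take the charge.
  ... | yes visited-j = record
    { T = T ; charged = λ k → δ j k + charged k ; d = d
    ; annotated = annotated
    ; avoids = λ { w (_ ∷ al) → avoids w al }
    ; within = within′
    ; charged-diag = charged-diag′
    ; diag-d = diag-d
    ; length≤ = ≤-trans (s≤s length≤) (+-monoˡ-≤ (length T) (sum-δ j charged))
    ; visited = λ { k (here refl) (_ ∷ al) → visited k (revisit al ¬fresh) al
                  ; k (there v) (_ ∷ al) → visited k v al }
    }
    where
    open Split S
    ¬adj-j : All (λ e → ¬ CAdj n m (layer e) j) E
    ¬adj-j = All.map (λ ¬c a → ¬c (inj₂ (outer a))) new
    charged-diag′ : ∀ k → δ j k + charged k ≡ 0 ⊎ Diag T k
    charged-diag′ k with j Fin.≟ k
    ... | yes refl = inj₂ (visited j visited-j ¬adj-j)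
    ... | no _ = charged-diag k
    within′ : ∀ k → ∃ λ Z → Annotated (G k) Z × length Z ≡ δ j k + charged k + d k ×
              (∀ y′ → All (λ e → ¬ proj₁ e ~ᴶ (k , y′)) (((i , x) , (j , y)) ∷ E) → All (λ z → ¬ CN (G k) (proj₁ z) y′) Z)
    within′ k with j Fin.≟ k | within k
    ... | no _ | Z , a , e , h = Z , a , e , λ { y′ (_ ∷ al) → h y′ al }
    ... | yes refl | Z , a , e , h with i Fin.≟ j
    ...   | yes refl = (x , y) ∷ Z , add (within-CN v~w) (h y new) a , cong suc e
                     , λ { y′ (¬c ∷ al) → (¬c ∘ within-CN⁻) ∷ h y′ al }
    -- A vertex of another layer is represented in `G j` by its footprint `y`. It dominates all of
    -- layer `j`, so the invariant on undominated vertices becomes vacuous.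
    ...   | no i≢j = (y , y) ∷ Z , add (inj₁ refl) (h y new) a , cong suc e
                   , λ { y′ (¬c ∷ al) → contradiction (dominates-layer y′) ¬c }
      where
      dominates-layer : ∀ y′ → (i , x) ~ᴶ (j , y′)
      dominates-layer y′ with layer-CN v~w
      ... | inj₁ e = contradiction (sym e) i≢j
      ... | inj₂ a = inj₂ (outer a)
  -- Fallback for sequences with fewer than two vertices: `u` is `m + 1` steps after `w`, and
  -- `2 * (m + 1) ≤ n` makes the other arc long enough.
  two-element-diagonal : ∀ w → ∃₂ λ u T → u ≢ w × Annotatedᶜ T × T ≡ (w , w) ∷ (u , u) ∷ []
  two-element-diagonal w = u , _ , (λ e → u≁w (inj₁ (sym e)))
                         , add (inj₁ refl) (u≁w ∷ []) (add (inj₁ refl) [] []) , refl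
    where
    u = (toℕ w + suc m) mod n
    u≁w : ¬ CNᶜ u w
    u≁w c = far m<n {toℕ w} {toℕ w + suc m} (+-monoʳ-< (toℕ w) (n<1+n m))
      (opposite (toℕ w)) (subst (λ v → CNᶜ v u) (sym (toℕ-mod-id w)) (CNᶜ-sym c))
      where
      opposite : ∀ t → t + suc m + m < t + n
      opposite t = lin 2m+2≤n 0 (solve (t & m & n & ∙))

  -- The earliest vertex may be taken to footprint itself.
  diagonalise-earliest : ∀ {e T} → Annotatedᶜ (e ∷ T) → ∃₂ λ T′ a → Annotatedᶜ T′ × length T′ ≡ length (e ∷ T) ×
    (∀ {k} → Diag (e ∷ T) k → Diag T′ k) × Diag T′ a × (∀ {w} → Undominated w (e ∷ T) → Undominated w T′)
  diagonalise-earliest {v , w} {[]} (add _ _ _) =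
    (v , v) ∷ [] , v , add (inj₁ refl) [] [] , refl , (λ { (here refl) → here refl }) , here refl
    , λ { (p ∷ []) → p ∷ [] }
  diagonalise-earliest {v , w} {_ ∷ _} (add c new A) with diagonalise-earliest A
  ... | T′ , a , A′ , len , mono , i , und =
    (v , w) ∷ T′ , a , add c (und new) A′ , cong suc len
    , (λ { (here e) → here e ; (there k) → there (mono k) }) , there i , λ { (p ∷ ps) → p ∷ und ps }

  -- The latest vertex may be replaced by the vertex it footprints.
  two-diagonals : ∀ {T} → Annotatedᶜ T → ∃ λ T′ → ∃₂ λ a b → Annotatedᶜ T′ × length T ≤ length T′ ×
    (∀ {k} → Diag T k → Diag T′ k) × Diag T′ a × Diag T′ b × a ≢ b
  two-diagonals [] with two-element-diagonal (0 mod n)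
  ... | u , T , u≢w , A , refl = T , _ , _ , A , z≤n , (λ ()) , there (here refl) , here refl , u≢w
  two-diagonals (add {v} {w} {[]} _ _ _) with two-element-diagonal w
  ... | u , T , u≢w , A , refl = T , _ , _ , A , s≤s z≤n , (λ { (here refl) → here refl })
                               , there (here refl) , here refl , u≢w
  two-diagonals (add {v} {w} {_ ∷ _} _ new A) with diagonalise-earliest A
  ... | T′ , a , A′ , len , mono , i , und =
    (w , w) ∷ T′ , a , w , add (inj₁ refl) (und new) A′ , s≤s (≤-reflexive (sym len))
    , (λ { (here refl) → here refl ; (there k) → there (mono k) }) , there i , here refl
    , λ a≡w → undominated⇒∉ (und new) (inj₁ (sym a≡w)) i

  module _ (g : Fin n → ℕ) (1≤g : ∀ i → 1 ≤ g i) (gn : ∀ i → GrundyNumber (G i) (g i)) where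

    -- `I` is the diagonal of `T′` rather than of `T`, since two elements are required; the charges
    -- still come from `T`, whose diagonal is contained in that of `T′`.
    upper-bound : ∀ {E} → Annotated (JAdj n m R) E →
                  ∃ λ I → IsI2 n m I × length E + length I * (m + 1) ≤ sum (map g I) + n
    upper-bound {E} A with split A
    ... | S with two-diagonals (Split.annotated S)
    ... | T′ , a , b , A′ , T≤T′ , mono , Da , Db , a≢b =
      I , I∈I2 , combine (length E) (sum (map charged (allFin n))) (length T) (length T′) (length I) (sum (map g I))
        length≤ T≤T′ (sum+length-filter≤ diag? charged g charged-diag′ charged<g (allFin n))
        (length-bound A′ I I∈I2 diags)
      where
      open Split S
      diag? : ∀ k → Dec (Diag T′ k)
      diag? k = any? (≡-dec Fin._≟_ Fin._≟_ (k , k)) T′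
      I : List (Fin n)
      I = filter diag? (allFin n)
      diags : All (Diag T′) I
      diags = Allₚ.all-filter diag? (allFin n)
      sorted : AllPairs (λ x y → toℕ x < toℕ y) I
      sorted = AllPairsₚ.filter⁺ diag? (AllPairsₚ.tabulate⁺-< id)
      I∈I2 : IsI2 n m I
      I∈I2 = sorted
           , AllPairs-zip (λ i j x<y → diag-independent A′ i j (λ { refl → <-irrefl refl x<y })) diags sorted
           , distinct⇒2≤length (∈-filter⁺ diag? (∈-allFin a) Da) (∈-filter⁺ diag? (∈-allFin b) Db) a≢b
      charged-diag′ : ∀ k → charged k ≡ 0 ⊎ Diag T′ k
      charged-diag′ k = map₂ mono (charged-diag k)
      charged<g : ∀ k → Diag T′ k → charged k < g k
      charged<g k _ with charged-diag k
      -- Without charge, as for a `k` that is self-footprinting only in `T′`, positivity of `g k`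
      -- suffices; otherwise the first visit counted by `d k` gives strictness.
      ... | inj₁ e = subst (_< g k) (sym e) (1≤g k)
      ... | inj₂ D with within k
      ...   | Z , AZ , len , _ = <-≤-trans (m<m+n (charged k) (diag-d k D))
                (subst (_≤ g k) len (annotated-≤ _ (G k) (gn k) AZ))
      combine : ∀ e c t t′ i s → e ≤ c + t → t ≤ t′ → c + i ≤ s → t′ + i * m ≤ n → e + i * (m + 1) ≤ s + n
      combine e c t t′ i s h₁ h₂ h₃ h₄ = lin (h₁ ⊕ h₂ ⊕ h₃ ⊕ h₄) 0 (solve (e & c & t & t′ & i & s & m & n & ∙))

grundy-positive : ∀ {N Adj k} → GrundyNumber {Fin N} Adj k → 0 < N → 1 ≤ k
grundy-positive {suc N} ((S , (_ , _ , dom) , refl) , _) _ with S | dom Fin.zero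
... | _ ∷ _ | _ = s≤s z≤n

-- Lists of consecutive integers, and last elements.

from : ℕ → ℕ → List ℕ
from a k = applyUpTo (a +_) k

down : ℕ → ℕ → List ℕ
down a zero    = []
down a (suc k) = a + k ∷ down a k

applyUpTo-cong : ∀ {A : Set} {f g : ℕ → A} → (∀ i → f i ≡ g i) → ∀ k → applyUpTo f k ≡ applyUpTo g k
applyUpTo-cong h zero    = refl
applyUpTo-cong h (suc k) = cong₂ _∷_ (h 0) (applyUpTo-cong (h ∘ suc) k)

from-suc : ∀ a k → from a (suc k) ≡ a ∷ from (suc a) k
from-suc a k = cong₂ _∷_ (+-identityʳ a) (applyUpTo-cong (+-suc a) k)

from-∷ʳ : ∀ a k → from a (suc k) ≡ from a k ∷ʳ (a + k)
from-∷ʳ a zero    = refl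
from-∷ʳ a (suc k) = trans (from-suc a (suc k)) (trans (cong (a ∷_) (from-∷ʳ (suc a) k))
  (cong₂ (λ xs y → xs ∷ʳ y) (sym (from-suc a k)) (sym (+-suc a k))))

reverse-from : ∀ a k → reverse (from a k) ≡ down a k
reverse-from a zero    = refl
reverse-from a (suc k) = trans (cong reverse (from-∷ʳ a k))
  (trans (reverse-++ (from a k) [ a + k ]) (cong (a + k ∷_) (reverse-from a k)))

-- The head is split off because it is the only entry of the block that lies in `I`.
range-from : ∀ m a d {b} → suc (a + m) + d ≡ b → range a (b ∸ (m + 1)) ≡ a ∷ from (suc a) d
range-from m a d refl = trans (cong (λ k → map (a +_) (upTo (suc k ∸ a))) (trans (cong (_∸ (m + 1)) (shift m a d)) (m+n∸n≡m (a + d) (m + 1))))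
  (trans (cong (λ k → map (a +_) (upTo k)) (trans (cong (_∸ a) (sym (+-suc a d))) (m+n∸m≡n a (suc d))))
  (trans (map-applyUpTo id (a +_) (suc d)) (from-suc a d)))
  where
  shift : ∀ m a d → suc (a + m) + d ≡ a + d + (m + 1)
  shift m a d = solve (m & a & d & ∙)

All-from : ∀ {P : ℕ → Set} a k → (∀ t → a ≤ t → t < a + k → P t) → All P (from a k)
All-from a k h = Allₚ.applyUpTo⁺₁ (a +_) k (λ i<k → h _ (m≤m+n a _) (+-monoʳ-< a i<k))

All-down : ∀ {P : ℕ → Set} a k → (∀ t → a ≤ t → t < a + k → P t) → All P (down a k)
All-down a zero    h = []
All-down a (suc k) h = h (a + k) (m≤m+n a k) (+-monoʳ-< a (n<1+n k))
                     ∷ All-down a k (λ t p q → h t p (<-trans q (+-monoʳ-< a (n<1+n k))))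

∈-from : ∀ {t} a k → a ≤ t → t < a + k → t ∈ from a k
∈-from a k a≤t t<a+k with m≤n⇒∃[o]m+o≡n a≤t
... | i , refl = Anyₚ.applyUpTo⁺ (a +_) refl (+-cancelˡ-< a i k t<a+k)

∈-down : ∀ {t} a k → a ≤ t → t < a + k → t ∈ down a k
∈-down a zero a≤t t<a+0 = contradiction (≤-<-trans a≤t t<a+0) (subst (a ≮_) (sym (+-identityʳ a)) (<-irrefl refl))
∈-down {t} a (suc k) a≤t t<a+1+k with t ≟ a + k
... | yes e = here e
... | no ≢ = there (∈-down a k a≤t (≤∧≢⇒< (≤-pred (subst (t <_) (+-suc a k) t<a+1+k)) ≢))

last : ∀ {A : Set} → A → List A → A
last a []       = a
last a (b ∷ xs) = last b xs

last-map : ∀ {n} (a : Fin n) xs → lastOr (toℕ a) (map toℕ xs) ≡ toℕ (last a xs)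
last-map a []       = refl
last-map a (b ∷ xs) = last-map b xs

last-∈ : ∀ {A : Set} (a : A) xs → last a xs ∈ a ∷ xs
last-∈ a []       = here refl
last-∈ a (b ∷ xs) = there (last-∈ b xs)

Sorted : ∀ {n} → List (Fin n) → Set
Sorted = AllPairs (λ x y → toℕ x < toℕ y)

last-max : ∀ {n} {a : Fin n} {xs} → Sorted (a ∷ xs) → ∀ {x} → x ∈ a ∷ xs → toℕ x ≤ toℕ (last a xs)
last-max {xs = []}     _ (here refl) = ≤-refl
last-max {xs = b ∷ xs} ((a<b ∷ _) ∷ s) (here refl) = ≤-trans (<⇒≤ a<b) (last-max s (here refl))
last-max {xs = b ∷ xs} (_ ∷ s) (there i) = last-max s i

-- The lower bound: legality and length of the expanded `SC`.

module Lower (n m : ℕ) .{{_ : NonZero n}} (2m+2≤n : 2 * (m + 1) ≤ n) (R : Fin n → FinGraph)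
             (S : (i : Fin n) → List (Fin (FinGraph.size (R i))))
             (S-legal : ∀ i → LegalDominating (FinGraph.Adj (R i)) (S i))
             (c : (i : Fin n) → Fin (FinGraph.size (R i))) where

  open Upper n m 2m+2≤n R

  module Expansion (I : List (Fin n)) where

    _∈I?_ : ∀ j (I : List (Fin n)) → Dec (j ∈ I)
    _∈I?_ = Mem._∈?_ n m R

    block : Fin n → List V
    block j = if does (j ∈I? I) then map (j ,_) (S j) else [ (j , c j) ]

    expandℕ : List ℕ → List V
    expandℕ ts = concatMap block (map (_mod n) ts)

    block-∈ : ∀ {j} → j ∈ I → block j ≡ map (j ,_) (S j)
    block-∈ {j} i with j ∈I? I
    ... | yes _ = refl
    ... | no ¬i = contradiction i ¬i

    All-block : ∀ {P : Fin n → Set} j → P j → All (P ∘ proj₁) (block j)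
    All-block j p with j ∈I? I
    ... | yes _ = Allₚ.map⁺ (All.universal (λ _ → p) (S j))
    ... | no _  = p ∷ []

    All-expand : ∀ {P : Fin n → Set} ts → All (λ t → P (t mod n)) ts → All (P ∘ proj₁) (expandℕ ts)
    All-expand [] [] = []
    All-expand (t ∷ ts) (p ∷ ps) = Allₚ.++⁺ (All-block (t mod n) p) (All-expand ts ps)

    expand-++ : ∀ ts us → expandℕ (ts ++ us) ≡ expandℕ ts ++ expandℕ us
    expand-++ ts us = trans (cong (concatMap block) (map-++ (_mod n) ts us))
                            (concatMap-++ block (map (_mod n) ts) (map (_mod n) us))

    expand-∷ʳ : ∀ ts t → expandℕ (ts ∷ʳ t) ≡ expandℕ ts ++ block (t mod n)
    expand-∷ʳ ts t = trans (expand-++ ts [ t ]) (cong (expandℕ ts ++_) (++-identityʳ _))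

    -- As no earlier layer is in the closed neighbourhood of `j`, domination inside layer `j` is
    -- that of `G j` alone.
    layer-footprints : ∀ {j} {pre : List V} → All (λ u → ¬ CNᶜ (proj₁ u) j) pre → ∀ q T →
      Footprints (G j) q T → Footprints (JAdj n m R) (pre ++ map (j ,_) q) (map (j ,_) T)
    layer-footprints free q [] _ = tt
    layer-footprints {j} {pre} free q (v ∷ T) ((w , v~w , new) , fp) =
      ((j , w) , within-CN⁻ v~w , Allₚ.++⁺ (All.map (_∘ layer-CN) free) (Allₚ.map⁺ (All.map (_∘ within-CN) new))) ,
      subst (λ p → Footprints (JAdj n m R) p (map (j ,_) T))
        (trans (cong (pre ++_) (map-++ (j ,_) q [ v ])) (sym (++-assoc pre (map (j ,_) q) [ (j , v) ])))
        (layer-footprints free (q ∷ʳ v) T fp)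

    -- Legality in a form that survives expansion: an element of `I` must footprint itself, so that
    -- its layer is wholly undominated when its sequence is inserted.
    Foot : List ℕ → ℕ → Set
    Foot pre t = ∃ λ w → CNᶜ (t mod n) w × (t mod n ∈ I → w ≡ t mod n) × All (λ u → ¬ CNᶜ (u mod n) w) pre

    Steps : List ℕ → List ℕ → Set
    Steps pre []       = ⊤
    Steps pre (t ∷ ts) = Foot pre t × Steps (pre ∷ʳ t) ts

    Steps-++ : ∀ {pre} ts {us} → Steps pre ts → Steps (pre ++ ts) us → Steps pre (ts ++ us)
    Steps-++ {pre} [] {us} _ s = subst (λ p → Steps p us) (++-identityʳ pre) s
    Steps-++ {pre} (t ∷ ts) {us} (f , s) s′ =
      f , Steps-++ ts s (subst (λ p → Steps p us) (sym (++-assoc pre [ t ] ts)) s′)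

    block-footprints : ∀ {pre t} → Foot pre t → Footprints (JAdj n m R) (expandℕ pre) (block (t mod n))
    block-footprints {pre} {t} (w , t~w , w≡t , free) with (t mod n) ∈I? I
    ... | yes i with w≡t i
    ...   | refl = subst (λ p → Footprints (JAdj n m R) p (map (w ,_) (S w))) (++-identityʳ (expandℕ pre))
                     (layer-footprints (All-expand pre free) [] (S w) (proj₁ (proj₂ (S-legal w))))
    block-footprints {pre} {t} (w , t~w , w≡t , free) | no _ =
      ((w , c w) , join t~w , All.map (_∘ layer-CN) (All-expand pre free)) , tt
      where
      join : CNᶜ (t mod n) w → (t mod n , c (t mod n)) ~ᴶ (w , c w)
      join (inj₁ refl) = inj₁ refl
      join (inj₂ a)    = inj₂ (outer a)

    expand-footprints : ∀ pre ts → Steps pre ts → Footprints (JAdj n m R) (expandℕ pre) (expandℕ ts)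
    expand-footprints pre [] _ = tt
    expand-footprints pre (t ∷ ts) (f , s) = Footprints-++ (JAdj n m R) (block (t mod n)) (block-footprints f)
      (subst (λ p → Footprints (JAdj n m R) p (expandℕ ts)) (expand-∷ʳ pre t) (expand-footprints (pre ∷ʳ t) ts s))

    block-nonempty : ∀ j → ∃ λ x → (j , x) ∈ block j
    block-nonempty j with j ∈I? I | S j | proj₂ (proj₂ (S-legal j)) (c j)
    ... | yes _ | x ∷ _ | _ = x , here refl
    ... | no _  | _     | _ = c j , here refl

    ∈-expand : ∀ {P : V → Set} {t ts} → t ∈ ts → Any P (block (t mod n)) → Any P (expandℕ ts)
    ∈-expand {ts = t ∷ ts} (here refl) a = Anyₚ.++⁺ˡ a
    ∈-expand {ts = t ∷ ts} (there i) a = Anyₚ.++⁺ʳ (block (t mod n)) (∈-expand i a)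

    block-length-pos : ∀ j → 1 ≤ length (block j)
    block-length-pos j with block j | block-nonempty j
    ... | _ ∷ _ | _ = s≤s z≤n

    expand-length-∷ : ∀ t ts → length (expandℕ (t ∷ ts)) ≡ length (block (t mod n)) + length (expandℕ ts)
    expand-length-∷ t ts = length-++ (block (t mod n))

    length≤expand : ∀ ts → length ts ≤ length (expandℕ ts)
    length≤expand [] = z≤n
    length≤expand (t ∷ ts) = ≤-trans (+-mono-≤ (block-length-pos (t mod n)) (length≤expand ts))
      (≤-reflexive (sym (expand-length-∷ t ts)))

    block-length-∈ : ∀ {j} → j ∈ I → length (block (toℕ j mod n)) ≡ length (S j)
    block-length-∈ {j} i rewrite toℕ-mod-id j | block-∈ i = length-map {B = V} (j ,_) (S j)
  ends-far : ∀ {a I} → IsI2 n m (a ∷ I) → toℕ a + m < toℕ (last a I) × toℕ (last a I) + m < toℕ a + n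
  ends-far {_} {[]} (_ , _ , s≤s ())
  ends-far {_} {b ∷ I} ((a< ∷ _) , (¬adj ∷ _) , _) =
    ¬CAdj⇒far (All.lookup a< (last-∈ b I)) (All.lookup ¬adj (last-∈ b I))

  module Sequence (a₀ : Fin n) (I₀ : List (Fin n)) (I∈I2 : IsI2 n m (a₀ ∷ I₀)) where

    I : List (Fin n)
    I = a₀ ∷ I₀

    open Expansion I

    z : Fin n
    z = last a₀ I₀

    i₁ p : ℕ
    i₁ = toℕ a₀
    p  = toℕ z

    I-sorted : Sorted I
    I-sorted = proj₁ I∈I2

    i₁-min : ∀ {x} → x ∈ I → i₁ ≤ toℕ x
    i₁-min (here refl) = ≤-refl
    i₁-min (there i) = <⇒≤ (All.lookup (AllPairs.head I-sorted) i)

    p-max : ∀ {x} → x ∈ I → toℕ x ≤ p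
    p-max = last-max I-sorted

    i₁+m<p : i₁ + m < p
    i₁+m<p = proj₁ (ends-far I∈I2)

    p+m<i₁+n : p + m < i₁ + n
    p+m<i₁+n = proj₂ (ends-far I∈I2)

    +m<i₁+n : ∀ {x} → x ∈ I → toℕ x + m < i₁ + n
    +m<i₁+n i = ≤-<-trans (+-monoˡ-≤ m (p-max i)) p+m<i₁+n

    -- An element of `I` congruent to `t` lies less than `n` away from `t`, hence equals it.
    between-∉I : ∀ {t} → i₁ ≤ t → t < i₁ + n → (∀ {x} → x ∈ I → toℕ x ≢ t) → t mod n ∉ I
    between-∉I {t} i₁≤t t<i₁+n ≢ i with <-cmp t (toℕ (t mod n))
    ... | tri< t<x _ _ = mod-≢ t<x (<-≤-trans (toℕ<n (t mod n)) (m≤n+m n t)) (sym (toℕ-mod-id (t mod n)))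
    ... | tri≈ _ e _ = ≢ i (sym e)
    ... | tri> _ _ x<t = mod-≢ x<t (<-≤-trans t<i₁+n (+-monoˡ-≤ n (i₁-min i))) (toℕ-mod-id (t mod n))

    -- Position `t` footprints `t + m`: earlier positions are too far behind to reach it forwards,
    -- and `hi` keeps it more than `m` before `i₁ + n`, out of their reach backwards.
    run-steps : ∀ t k pre → All (λ u → i₁ ≤ u × u < t) pre → i₁ ≤ t → t + k + m + m ≤ i₁ + n →
                (∀ s → t ≤ s → s < t + k → s mod n ∉ I) → Steps pre (from t k)
    run-steps t zero    pre _ _ _ _ = tt
    run-steps t (suc k) pre lo i₁≤t hi ∉I = subst (Steps pre) (sym (from-suc t k))
      ( ( (t + m) mod n , near m<n (m≤m+n t m) ≤-refl
        , (λ i → contradiction i (∉I t ≤-refl (m<m+n t z<s)))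
        , All.map (λ { {u} (i₁≤u , u<t) → far m<n (+-monoˡ-< m u<t)
            (<-≤-trans (close t k m) (≤-trans hi (+-monoˡ-≤ n i₁≤u))) }) lo )
      , run-steps (suc t) k (pre ∷ʳ t)
          (Allₚ.∷ʳ⁺ (All.map (λ { (q , r) → q , <-trans r (n<1+n t) }) lo) (i₁≤t , n<1+n t))
          (≤-trans i₁≤t (n≤1+n t)) (subst (λ x → x + m + m ≤ i₁ + n) (+-suc t k) hi)
          (λ s q r → ∉I s (<⇒≤ q) (subst (s <_) (sym (+-suc t k)) r)) )
      where
      close : ∀ t k m → t + m + m < t + suc k + m + m
      close t k m = lin (≤-refl {0}) k (solve (t & k & m & ∙))

    -- With sortedness, this rules out elements of `I` strictly between `a` and the head of `xs`.
    Above : Fin n → List (Fin n) → Set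
    Above a xs = ∀ {x} → x ∈ I → toℕ x ≤ toℕ a ⊎ x ∈ xs

    above-tail : ∀ {a b xs} → toℕ a < toℕ b → Above a (b ∷ xs) → Above b xs
    above-tail a<b h i with h i
    ... | inj₁ x≤a         = inj₁ (≤-trans x≤a (<⇒≤ a<b))
    ... | inj₂ (here refl) = inj₁ ≤-refl
    ... | inj₂ (there j)   = inj₂ j

    -- The prefix stays more than `m` before `a`, so `a` can footprint itself; the returned bound
    -- says the same about `p` once all blocks are done.
    blocks-steps : ∀ a xs pre → Sorted (a ∷ xs) → AllPairs (λ x y → ¬ CAdj n m x y) (a ∷ xs) →
      (∀ {x} → x ∈ a ∷ xs → x ∈ I) → Above a xs → last a xs ≡ z → All (λ u → i₁ ≤ u × u + m < toℕ a) pre →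
      Steps pre (blocks m (map toℕ (a ∷ xs))) × All (λ u → i₁ ≤ u × u + m < p) (blocks m (map toℕ (a ∷ xs)))
    blocks-steps a [] pre _ _ _ _ _ _ = tt , []
    blocks-steps a (b ∷ xs) pre ((a<b ∷ a<xs) ∷ sorted) ((¬ab ∷ _) ∷ indep) ⊆I above last≡z lo
      with m≤n⇒∃[o]m+o≡n (proj₁ (¬CAdj⇒far a<b ¬ab))
    ... | d , e = Steps-++ (range (toℕ a) (toℕ b ∸ (m + 1))) steps₁ steps₂
                , Allₚ.++⁺ (All.map (λ { (i₁≤u , h) → i₁≤u , <-≤-trans h (p-max b∈I) }) bounds) (proj₂ rest)
      where
      a∈I : a ∈ I
      a∈I = ⊆I (here refl)
      b∈I : b ∈ I
      b∈I = ⊆I (there (here refl))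
      i₁≤a : i₁ ≤ toℕ a
      i₁≤a = i₁-min a∈I
      run≡ : range (toℕ a) (toℕ b ∸ (m + 1)) ≡ toℕ a ∷ from (suc (toℕ a)) d
      run≡ = range-from m (toℕ a) d e
      shift : ∀ a d → suc a + d + m ≡ suc (a + m) + d
      shift a d = solve (a & d & m & ∙)
      fits : suc (toℕ a) + d + m ≡ toℕ b
      fits = trans (shift (toℕ a) d) e
      a<t⇒∉I : ∀ t → toℕ a < t → t < suc (toℕ a) + d → t mod n ∉ I
      a<t⇒∉I t a<t t< = between-∉I (≤-trans i₁≤a (<⇒≤ a<t))
        (<-trans t<b (≤-<-trans (m≤m+n (toℕ b) m) (+m<i₁+n b∈I))) λ i eq → miss i eq
        where
        t<b : t < toℕ b
        t<b = <-≤-trans t< (subst (suc (toℕ a) + d ≤_) fits (m≤m+n _ m))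
        miss : ∀ {x} → x ∈ I → toℕ x ≢ t
        miss i eq with above i
        ... | inj₁ x≤a         = <⇒≱ a<t (subst (_≤ toℕ a) eq x≤a)
        ... | inj₂ (here refl) = <-irrefl (sym eq) t<b
        ... | inj₂ (there j)   = <⇒≱ t<b (subst (toℕ b ≤_) eq (<⇒≤ (All.lookup (AllPairs.head sorted) j)))
      steps₁ : Steps pre (range (toℕ a) (toℕ b ∸ (m + 1)))
      steps₁ = subst (Steps pre) (sym run≡)
        ( ( a , inj₁ (sym (toℕ-mod-id a)) , (λ _ → sym (toℕ-mod-id a))
          , All.map (λ { {u} (i₁≤u , h) ~a → far m<n h (<-≤-trans (+m<i₁+n a∈I) (+-monoˡ-≤ n i₁≤u))
                         (subst (CNᶜ (u mod n)) (sym (toℕ-mod-id a)) ~a) }) lo )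
        , run-steps (suc (toℕ a)) d (pre ∷ʳ toℕ a)
            (Allₚ.∷ʳ⁺ (All.map (λ { {u} (i₁≤u , h) → i₁≤u , <-trans (≤-<-trans (m≤m+n u m) h) (n<1+n (toℕ a)) }) lo) (i₁≤a , n<1+n (toℕ a)))
            (≤-trans i₁≤a (n≤1+n _))
            (subst (λ y → y + m ≤ i₁ + n) (sym fits) (<⇒≤ (+m<i₁+n b∈I))) a<t⇒∉I )
      bounds : All (λ u → i₁ ≤ u × u + m < toℕ b) (range (toℕ a) (toℕ b ∸ (m + 1)))
      bounds = subst (All _) (sym (trans run≡ (sym (from-suc (toℕ a) d))))
        (All-from (toℕ a) (suc d) λ t a≤t t< → ≤-trans i₁≤a a≤t ,
          subst (t + m <_) fits (+-monoˡ-< m (subst (t <_) (+-suc (toℕ a) d) t<)))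
      rest = blocks-steps b xs (pre ++ range (toℕ a) (toℕ b ∸ (m + 1))) sorted indep (⊆I ∘ there)
        (above-tail a<b above) last≡z
        (Allₚ.++⁺ (All.map (λ { (i₁≤u , h) → i₁≤u , <-trans h a<b }) lo) bounds)
      steps₂ : Steps (pre ++ range (toℕ a) (toℕ b ∸ (m + 1))) (blocks m (map toℕ (b ∷ xs)))
      steps₂ = proj₁ rest

    base : ℕ
    base = p + (m + 1)

    -- Mirror image of `run-steps`: each position footprints the one `m` below it. The blocks end
    -- more than `m` before `p`, and the reversed run has so far visited only higher positions.
    down-steps : ∀ k pre → base + k ≤ i₁ + n →
      All (λ u → (i₁ ≤ u × u + m < p) ⊎ (base + k ≤ u × u < i₁ + n)) pre → Steps pre (down base k)
    down-steps zero    pre _ _ = tt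
    down-steps (suc k) pre hi past =
      ( (p + 1 + k) mod n
      , CNᶜ-sym (near m<n (≤-trans (m≤m+n (p + 1 + k) m) (≤-reflexive (footprint p k))) (≤-reflexive (sym (footprint p k))))
      , (λ i → contradiction i (between-∉I (≤-trans (<⇒≤ (≤-<-trans (m≤m+n i₁ m) i₁+m<p)) (<⇒≤ p<base+k))
                 (<-≤-trans (+-monoʳ-< base (n<1+n k)) hi)
                 (λ j e → <⇒≱ p<base+k (subst (_≤ p) e (p-max j)))))
      , All.map (λ { {u} (inj₁ (i₁≤u , h)) → far m<n (<-trans h (<-≤-trans (m<m+n p z<s) (m≤m+n (p + 1) k)))
                       (subst (_< u + n) (sym (footprint p k))
                         (<-≤-trans (+-monoʳ-< base (n<1+n k)) (≤-trans hi (+-monoˡ-≤ n i₁≤u))))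
                   ; {u} (inj₂ (h , u<)) ~w → far m<n {p + 1 + k} {u}
                       (<-≤-trans (subst (_< base + suc k) (sym (footprint p k)) (+-monoʳ-< base (n<1+n k))) h)
                       (wrap u i₁ p k u< i₁+m<p) (CNᶜ-sym ~w) }) past )
      , down-steps k (pre ∷ʳ (base + k)) (≤-trans (+-monoʳ-≤ base (n≤1+n k)) hi)
          (Allₚ.∷ʳ⁺ (All.map (λ { (inj₁ h) → inj₁ h ; (inj₂ (h , r)) → inj₂ (≤-trans (+-monoʳ-≤ base (n≤1+n k)) h , r) }) past)
            (inj₂ (≤-refl , <-≤-trans (+-monoʳ-< base (n<1+n k)) hi)))
      where
      footprint : ∀ p k → p + 1 + k + m ≡ p + (m + 1) + k
      footprint p k = solve (p & k & m & ∙)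
      p<base+k : p < base + k
      p<base+k = <-≤-trans (m<m+n p (≤-trans (s≤s z≤n) (m≤n+m 1 m))) (m≤m+n base k)
      wrap : ∀ u i₁ p k → u < i₁ + n → i₁ + m < p → u + m < p + 1 + k + n
      wrap u i₁ p k h₁ h₂ = lin (h₁ ⊕ h₂) (2 + k) (solve (u & i₁ & p & k & m & n & ∙))

    k : ℕ
    k = i₁ + n ∸ base

    base+k : base + k ≡ i₁ + n
    base+k = m+[n∸m]≡n (subst (_≤ i₁ + n) (trans (sym (+-suc p m)) (cong (p +_) (+-comm 1 m))) p+m<i₁+n)

    bs ts : List ℕ
    bs = blocks m (map toℕ I)
    ts = bs ++ down base k ++ [ p ]

    SC≡ : SC n m I ≡ map (_mod n) ts
    SC≡ rewrite last-map a₀ I₀ = cong (λ xs → map (_mod n) (bs ++ xs ++ [ p ]))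
      (trans (cong reverse (map-applyUpTo id (base +_) k)) (reverse-from base k))

    z∈I : z ∈ I
    z∈I = last-∈ a₀ I₀

    ts-steps : Steps [] ts
    ts-steps = Steps-++ bs (proj₁ blocks-ok) (Steps-++ (down base k)
      (down-steps k bs (≤-reflexive base+k) (All.map inj₁ (proj₂ blocks-ok)))
      -- `p` can still footprint itself at the end: the blocks stay more than `m` below it, the
      -- reversed run at least `m + 1` above it.
      ((z , inj₁ (sym (toℕ-mod-id z)) , (λ _ → sym (toℕ-mod-id z)) , Allₚ.++⁺
          (All.map (λ { {u} (i₁≤u , h) → subst (λ v → ¬ CNᶜ (u mod n) v) (toℕ-mod-id z)
             (far m<n h (<-≤-trans p+m<i₁+n (+-monoˡ-≤ n i₁≤u))) }) (proj₂ blocks-ok))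
          (All-down base k λ u base≤u u< ~z → far m<n {p} {u}
             (<-≤-trans (≤-reflexive (trans (sym (+-suc p m)) (cong (p +_) (+-comm 1 m)))) base≤u)
             (wrap u i₁ p (subst (u <_) base+k u<) i₁+m<p)
             (CNᶜ-sym (subst (CNᶜ (u mod n)) (sym (toℕ-mod-id z)) ~z))))
      , tt))
      where
      blocks-ok = blocks-steps a₀ I₀ [] I-sorted (proj₁ (proj₂ I∈I2)) id
        (λ { (here refl) → inj₁ ≤-refl ; (there i) → inj₂ i }) refl []
      wrap : ∀ u i₁ p → u < i₁ + n → i₁ + m < p → u + m < p + n
      wrap u i₁ p h₁ h₂ = lin (h₁ ⊕ h₂) 1 (solve (u & i₁ & p & m & n & ∙))

    -- A telescoping sum: the block from `a` to `b` has `b - a - m` entries, the first expanding to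
    -- `g a` vertices. The last element is emitted only after the reversed run, hence its `g` on the
    -- right.
    blocks-length : ∀ (g : Fin n → ℕ) → (∀ i → length (S i) ≡ g i) → ∀ a xs → Sorted (a ∷ xs) →
      AllPairs (λ x y → ¬ CAdj n m x y) (a ∷ xs) → (∀ {x} → x ∈ a ∷ xs → x ∈ I) →
      sum (map g (a ∷ xs)) + toℕ (last a xs)
        ≤ length (expandℕ (blocks m (map toℕ (a ∷ xs)))) + length xs * (m + 1) + toℕ a + g (last a xs)
    blocks-length g S≡g a [] _ _ _ = ≤-reflexive (exchange (g a) (toℕ a))
      where
      exchange : ∀ x y → x + 0 + y ≡ 0 + 0 + y + x
      exchange x y = solve (x & y & ∙)
    blocks-length g S≡g a (b ∷ xs) ((a<b ∷ _) ∷ sorted) ((¬ab ∷ _) ∷ indep) ⊆I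
      with m≤n⇒∃[o]m+o≡n (proj₁ (¬CAdj⇒far a<b ¬ab))
    ... | d , e = combine (g a) _ _ _ _ (toℕ a) (toℕ b) _ _ (length xs) d e block-length
                    (blocks-length g S≡g b xs sorted indep (⊆I ∘ there))
                    (trans (cong length (expand-++ (range (toℕ a) (toℕ b ∸ (m + 1))) _)) (length-++ (expandℕ (range (toℕ a) (toℕ b ∸ (m + 1))))))
      where
      run≡ : range (toℕ a) (toℕ b ∸ (m + 1)) ≡ toℕ a ∷ from (suc (toℕ a)) d
      run≡ = range-from m (toℕ a) d e
      block-length : g a + d ≤ length (expandℕ (range (toℕ a) (toℕ b ∸ (m + 1))))
      block-length rewrite run≡ | expand-length-∷ (toℕ a) (from (suc (toℕ a)) d) | block-length-∈ (⊆I (here refl)) | S≡g a =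
        +-monoʳ-≤ (g a) (subst (_≤ length (expandℕ (from (suc (toℕ a)) d))) (length-applyUpTo (suc (toℕ a) +_) d)
          (length≤expand (from (suc (toℕ a)) d)))
      combine : ∀ ga l₁ l₂ l s a b z gz x d → suc (a + m) + d ≡ b → ga + d ≤ l₁ →
                s + z ≤ l₂ + x * (m + 1) + b + gz → l ≡ l₁ + l₂ → ga + s + z ≤ l + suc x * (m + 1) + a + gz
      combine ga l₁ l₂ l s a b z gz x d refl h₁ h₂ refl =
        lin (h₁ ⊕ h₂) 0 (solve (ga & l₁ & l₂ & s & a & z & gz & x & d & m & ∙))

    length-down : ∀ a k → length (down a k) ≡ k
    length-down a zero    = refl
    length-down a (suc k) = cong suc (length-down a k)

    sequence-length : ∀ (g : Fin n → ℕ) → (∀ i → length (S i) ≡ g i) →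
      sum (map g I) + n ≤ length (expand n m R c S I (SC n m I)) + length I * (m + 1)
    sequence-length g S≡g rewrite SC≡ =
      combine (sum (map g I)) _ _ _ i₁ p (g z) (length I₀) k base+k
        (blocks-length g S≡g a₀ I₀ I-sorted (proj₁ (proj₂ I∈I2)) id)
        (subst (_≤ length (expandℕ (down base k))) (length-down base k) (length≤expand (down base k)))
        (trans (cong length (trans (expand-++ bs _) (cong (expandℕ bs ++_) (expand-++ (down base k) [ p ]))))
          (trans (length-++ (expandℕ bs)) (cong (length (expandℕ bs) +_) (trans (length-++ (expandℕ (down base k)))
            (cong (length (expandℕ (down base k)) +_) (trans (expand-length-∷ p [])
              (trans (+-identityʳ _) (trans (block-length-∈ z∈I) (S≡g z)))))))))
      where
      combine : ∀ s l lb ld i p gz x k → p + (m + 1) + k ≡ i + n → s + p ≤ lb + x * (m + 1) + i + gz → k ≤ ld →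
                l ≡ lb + (ld + gz) → s + n ≤ l + suc x * (m + 1)
      combine s l lb ld i p gz x k e h₁ h₂ refl =
        lin (h₁ ⊕ h₂ ⊕ ≤-reflexive (sym e)) 0 (solve (s & lb & ld & i & p & gz & x & k & m & n & ∙))

    -- Each element but the last heads its own block.
    I⊆ts : ∀ a xs → Sorted (a ∷ xs) → AllPairs (λ x y → ¬ CAdj n m x y) (a ∷ xs) →
           ∀ {x} → x ∈ a ∷ xs → toℕ x ∈ blocks m (map toℕ (a ∷ xs)) ++ [ toℕ (last a xs) ]
    I⊆ts a [] _ _ (here refl) = here refl
    I⊆ts a (b ∷ xs) ((a<b ∷ _) ∷ sorted) ((¬ab ∷ _) ∷ indep) {x} i
      with m≤n⇒∃[o]m+o≡n (proj₁ (¬CAdj⇒far a<b ¬ab))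
    ... | d , e = subst (toℕ x ∈_) (sym (++-assoc (range (toℕ a) (toℕ b ∸ (m + 1))) _ _)) (go i)
      where
      run≡ : range (toℕ a) (toℕ b ∸ (m + 1)) ≡ toℕ a ∷ from (suc (toℕ a)) d
      run≡ = range-from m (toℕ a) d e
      go : x ∈ a ∷ b ∷ xs → toℕ x ∈ range (toℕ a) (toℕ b ∸ (m + 1)) ++ (blocks m (map toℕ (b ∷ xs)) ++ [ toℕ (last b xs) ])
      go (here refl) = ∈-++⁺ˡ (subst (toℕ a ∈_) (sym run≡) (here refl))
      go (there j)   = ∈-++⁺ʳ (range (toℕ a) (toℕ b ∸ (m + 1))) (I⊆ts b xs sorted indep j)

    near-adjacent : ∀ {s t} → s < t → t ≤ s + m → CAdj n m (s mod n) (t mod n)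
    near-adjacent {s} {t} s<t t≤s+m with near m<n (<⇒≤ s<t) t≤s+m
    ... | inj₁ e = contradiction (sym e) (mod-≢ s<t (≤-<-trans t≤s+m (+-monoʳ-< s m<n)))
    ... | inj₂ a = a

    -- Outside `I` a layer holds a single chosen vertex, which may not dominate it, so a visited
    -- neighbouring layer is demanded there.
    Covered : ℕ → Set
    Covered t = t mod n ∈ I ⊎ ∃ λ u → u ∈ ts × CAdj n m (u mod n) (t mod n)

    module _ (1≤m : 1 ≤ m) (I⊆ : ∀ {x} → x ∈ I → toℕ x ∈ ts) where

      cover : ∀ a xs → Sorted (a ∷ xs) → AllPairs (λ x y → ¬ CAdj n m x y) (a ∷ xs) →
        (∀ {x} → x ∈ a ∷ xs → x ∈ I) → last a xs ≡ z → (∀ {u} → u ∈ blocks m (map toℕ (a ∷ xs)) → u ∈ ts) →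
        ∀ t → toℕ a ≤ t → t < i₁ + n → Covered t
      cover a xs sorted indep ⊆I last≡z b⊆ t a≤t t<i₁+n with m≤n⇒m<n∨m≡n a≤t
      ... | inj₂ refl = inj₁ (subst (_∈ I) (sym (toℕ-mod-id a)) (⊆I (here refl)))
      ... | inj₁ a<t with t ≤? toℕ a + m
      ... | yes t≤a+m = inj₂ (toℕ a , I⊆ (⊆I (here refl)) , near-adjacent a<t t≤a+m)
      cover a [] sorted indep ⊆I refl b⊆ t a≤t t<i₁+n | inj₁ a<t | no t≰a+m with i₁ + n ≤? t + m
      ... | yes h = inj₂ (i₁ , I⊆ (here refl) , subst (λ v → CAdj n m v (t mod n)) ([p+n]-mod i₁)
                      (CAdj-sym (near-adjacent t<i₁+n h)))
      -- More than `m` away from `p` and from `i₁ + n`, the next position belongs to the reversed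
      -- run, and `1 ≤ m` makes it adjacent.
      ... | no h = inj₂ (suc t
                      , ∈-++⁺ʳ bs (∈-++⁺ˡ (∈-down base k (≤-trans (≤-reflexive (trans (cong (p +_) (+-comm m 1)) (+-suc p m)))
                            (≤-trans (≰⇒> t≰a+m) (n≤1+n t)))
                          (subst (suc t <_) (sym base+k) (≤-<-trans (≤-trans (≤-reflexive (+-comm 1 t)) (+-monoʳ-≤ t 1≤m)) (≰⇒> h)))))
                      , CAdj-sym (near-adjacent (n<1+n t) (≤-trans (≤-reflexive (+-comm 1 t)) (+-monoʳ-≤ t 1≤m))))
      cover a (b ∷ xs) ((a<b ∷ _) ∷ sorted) ((¬ab ∷ _) ∷ indep) ⊆I last≡z b⊆ t a≤t t<i₁+n | inj₁ a<t | no t≰a+m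
        with toℕ b ≤? t
      ... | yes b≤t = cover b xs sorted indep (⊆I ∘ there) last≡z (b⊆ ∘ ∈-++⁺ʳ (range (toℕ a) (toℕ b ∸ (m + 1)))) t b≤t t<i₁+n
      ... | no b≰t with toℕ b ≤? t + m
      ...   | yes h = inj₂ (toℕ b , I⊆ (⊆I (there (here refl))) , CAdj-sym (near-adjacent (≰⇒> b≰t) h))
      cover a (b ∷ xs) ((a<b ∷ _) ∷ sorted) ((¬ab ∷ _) ∷ indep) ⊆I last≡z b⊆ (suc t) a≤t t<i₁+n | inj₁ a<t | no t≰a+m | no b≰t | no h
        with m≤n⇒∃[o]m+o≡n (proj₁ (¬CAdj⇒far a<b ¬ab))
      -- More than `m` away from both `a` and `b`, the preceding position belongs to the block of
      -- `a`.
      ... | d , e = inj₂ (t , b⊆ (∈-++⁺ˡ (subst (t ∈_) (sym (trans run≡ (sym (from-suc (toℕ a) d))))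
                       (∈-from (toℕ a) (suc d) (≤-pred a<t)
                         (+-cancelʳ-< m t _ (<-≤-trans (<-trans (n<1+n (t + m)) (≰⇒> h)) (≤-reflexive (trans (sym e) (shift (toℕ a) d))))))))
                   , near-adjacent (n<1+n t) (≤-trans (≤-reflexive (+-comm 1 t)) (+-monoʳ-≤ t 1≤m)))
        where
        run≡ : range (toℕ a) (toℕ b ∸ (m + 1)) ≡ toℕ a ∷ from (suc (toℕ a)) d
        run≡ = range-from m (toℕ a) d e
        shift : ∀ a d → suc (a + m) + d ≡ a + suc d + m
        shift a d = solve (a & d & m & ∙)

    sequence-legal : 1 ≤ m → LegalDominating (JAdj n m R) (expand n m R c S I (SC n m I))
    sequence-legal 1≤m rewrite SC≡ =
      proj₁ (Footprints⇒Unique (JAdj n m R) [] _ footprints) , footprints , dominates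
      where
      footprints : Footprints (JAdj n m R) [] (expandℕ ts)
      footprints = expand-footprints [] ts ts-steps
      I⊆ : ∀ {x} → x ∈ I → toℕ x ∈ ts
      I⊆ i with Anyₚ.++⁻ bs (I⊆ts a₀ I₀ I-sorted (proj₁ (proj₂ I∈I2)) i)
      ... | inj₁ j = ∈-++⁺ˡ j
      ... | inj₂ j = ∈-++⁺ʳ bs (∈-++⁺ʳ (down base k) j)
      at : ∀ t → i₁ ≤ t → t < i₁ + n → Covered t
      at = cover 1≤m I⊆ a₀ I₀ I-sorted (proj₁ (proj₂ I∈I2)) id refl ∈-++⁺ˡ
      covered : ∀ j → ∃ λ t → t mod n ≡ j × Covered t
      covered j with i₁ ≤? toℕ j
      ... | yes i₁≤j = toℕ j , toℕ-mod-id j , at (toℕ j) i₁≤j (<-≤-trans (toℕ<n j) (m≤n+m n i₁))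
      ... | no i₁≰j = toℕ j + n , trans ([p+n]-mod (toℕ j)) (toℕ-mod-id j)
                    , at (toℕ j + n) (≤-trans (<⇒≤ (toℕ<n a₀)) (m≤n+m n (toℕ j))) (+-monoˡ-< n (≰⇒> i₁≰j))
      dominates : Dominates (JAdj n m R) (expandℕ ts)
      dominates (j , y) with covered j
      ... | t , refl , inj₁ i = ∈-expand (I⊆ i)
        (subst (Any (_~ᴶ (t mod n , y))) (sym (trans (cong block (toℕ-mod-id (t mod n))) (block-∈ i)))
          (Anyₚ.map⁺ (Any.map within-CN⁻ (proj₂ (proj₂ (S-legal (t mod n))) y))))
      ... | t , refl , inj₂ (u , u∈ts , adj) with block-nonempty (u mod n)
      ...   | x , x∈ = ∈-expand u∈ts (Any.map (λ { refl → inj₂ (outer adj) }) x∈)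

-- A finite list of candidates for `I`.

lists≤ : ∀ {n} → ℕ → List (List (Fin n))
lists≤ zero = [ [] ]
lists≤ {n} (suc k) = [] ∷ concatMap (λ x → map (x ∷_) (lists≤ k)) (allFin n)

∈-lists≤ : ∀ {n} k (xs : List (Fin n)) → length xs ≤ k → xs ∈ lists≤ k
∈-lists≤ zero    []       _ = here refl
∈-lists≤ (suc k) []       _ = here refl
∈-lists≤ {n} (suc k) (x ∷ xs) (s≤s le) =
  there (∈-concatMap⁺ (λ x → map (x ∷_) (lists≤ k)) {xs = allFin n}
    (Any.map (λ { refl → ∈-map⁺ (x ∷_) (∈-lists≤ k xs le) }) (∈-allFin x)))

-- Ensures that every member of the family occurs in `lists≤ n`.
sorted-length : ∀ {n} (a : Fin n) xs → Sorted (a ∷ xs) → toℕ a + length (a ∷ xs) ≤ n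
sorted-length a [] _ = ≤-trans (≤-reflexive (+-comm (toℕ a) 1)) (toℕ<n a)
sorted-length a (b ∷ xs) ((a<b ∷ _) ∷ sorted) = ≤-trans (≤-reflexive (+-suc (toℕ a) _))
  (≤-trans (+-monoˡ-≤ (length (b ∷ xs)) a<b) (sorted-length b xs sorted))

-- Imported only here because +_ clashes with sections of the addition of ℕ.
open import Data.Integer as ℤ using (+_)

-- Passage to the integer objective, and the equality of the two bounds.

ℤ-cancel : ∀ x y → x ℤ.+ y ℤ.- y ≡ x
ℤ-cancel x y = ℤSolver.solve (x & y & ∙)

ℤ-move : ∀ x y z → x ℤ.+ z ℤ.- y ≡ x ℤ.- y ℤ.+ z
ℤ-move x y z = ℤSolver.solve (x & y & z & ∙)

-- Counting is done in ℕ without subtraction; this lemma and the next carry it over to `obj`, which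
-- may be negative.
objective-≥ : ∀ {a b s n} → a + b ≤ s + n → + a ℤ.≤ + s ℤ.- + b ℤ.+ + n
objective-≥ {a} {b} {s} {n} h = subst (ℤ._≤ _) (ℤ-cancel (+ a) (+ b))
  (subst (+ a ℤ.+ + b ℤ.- + b ℤ.≤_) (ℤ-move (+ s) (+ b) (+ n)) (ℤₚ.+-monoˡ-≤ (ℤ.- + b) (ℤ.+≤+ h)))

objective-≤ : ∀ {a b s n} → s + n ≤ a + b → + s ℤ.- + b ℤ.+ + n ℤ.≤ + a
objective-≤ {a} {b} {s} {n} h = subst (_ ℤ.≤_) (ℤ-cancel (+ a) (+ b))
  (subst (ℤ._≤ + a ℤ.+ + b ℤ.- + b) (ℤ-move (+ s) (+ b) (+ n)) (ℤₚ.+-monoˡ-≤ (ℤ.- + b) (ℤ.+≤+ h)))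

module Main (n m : ℕ) .{{_ : NonZero n}} (1≤m : 1 ≤ m) (2m+2≤n : 2 * (m + 1) ≤ n)
            (R : Fin n → FinGraph) (nonempty : ∀ i → 0 < FinGraph.size (R i))
            (g : Fin n → ℕ) (gn : ∀ i → GrundyNumber (FinGraph.Adj (R i)) (g i)) where

  open Upper n m 2m+2≤n R

  bound : ∀ {E} → Annotated (JAdj n m R) E →
          ∃ λ I → IsI2 n m I × length E + length I * (m + 1) ≤ sum (map g I) + n
  bound = upper-bound g (λ i → grundy-positive (gn i) (nonempty i)) gn

  IsI2? : ∀ I → Dec (IsI2 n m I)
  IsI2? I = allPairs? (λ a b → toℕ a <? toℕ b) I ×-dec allPairs? (λ a b → ¬? (CAdj? a b)) I ×-dec (2 ≤? length I)

  Optimal : List (Fin n) → Set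
  Optimal I = IsI2 n m I × (∀ I′ → IsI2 n m I′ → obj m g I′ ℤ.≤ obj m g I)

  IsI2⇒length≤n : ∀ {I} → IsI2 n m I → length I ≤ n
  IsI2⇒length≤n {[]}     _ = z≤n
  IsI2⇒length≤n {a ∷ I} (sorted , _) = ≤-trans (m≤n+m _ (toℕ a)) (sorted-length a I sorted)

  optimum : ∃ Optimal
  optimum = Extrema.argmax (obj m g) I₀ candidates
          , Extrema.argmax-all (obj m g) I₀∈I2 (Allₚ.all-filter IsI2? (lists≤ n))
          , λ I I∈I2 → All.lookup (Extrema.f[xs]≤f[argmax] {f = obj m g} I₀ candidates)
              (∈-filter⁺ IsI2? (∈-lists≤ n I (IsI2⇒length≤n I∈I2)) I∈I2)
    where
    I₀ : List (Fin n)
    -- The upper bound for the empty sequence already yields a member of the family, the default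
    -- value of `argmax`.
    I₀ = proj₁ (bound [])
    I₀∈I2 : IsI2 n m I₀
    I₀∈I2 = proj₁ (proj₂ (bound []))
    candidates : List (List (Fin n))
    candidates = filter IsI2? (lists≤ n)

  -- The bound comes with a set `I′` depending on `T`; optimality of `I` absorbs it.
  legal≤ : ∀ {I T} → Optimal I → LegalDominating (JAdj n m R) T → + length T ℤ.≤ obj m g I ℤ.+ + n
  legal≤ {I} {T} (_ , max) (_ , fp , _) with annotate (JAdj n m R) [] T fp [] (λ _ _ → [])
  ... | E , A , len with bound A
  ...   | I′ , I′∈I2 , h = ℤₚ.≤-trans (subst (λ l → + l ℤ.≤ obj m g I′ ℤ.+ + n) len (objective-≥ h))
                             (ℤₚ.+-monoˡ-≤ (+ n) (max I′ I′∈I2))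

  module _ (S : (i : Fin n) → List (Fin (FinGraph.size (R i)))) (S-legal : ∀ i → LegalDominating (G i) (S i))
           (S≡g : ∀ i → length (S i) ≡ g i) (c : (i : Fin n) → Fin (FinGraph.size (R i))) where

    expanded : List (Fin n) → List V
    expanded I = expand n m R c S I (SC n m I)

    expanded-legal : ∀ {I} → IsI2 n m I → LegalDominating (JAdj n m R) (expanded I)
    expanded-legal {[]} (_ , _ , ())
    expanded-legal {a ∷ I} I∈I2 = Lower.Sequence.sequence-legal n m 2m+2≤n R S S-legal c a I I∈I2 1≤m

    -- For optimal `I` the two one-sided counts meet: `legal≤` from above, `sequence-length` from
    -- below.
    expanded-length : ∀ {I} → Optimal I → + length (expanded I) ≡ obj m g I ℤ.+ + n
    expanded-length {[]} ((_ , _ , ()) , _)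
    expanded-length {a ∷ I} opt@(I∈I2 , _) = ℤₚ.≤-antisym (legal≤ opt (expanded-legal I∈I2))
      (objective-≤ (Lower.Sequence.sequence-length n m 2m+2≤n R S S-legal c a I I∈I2 g S≡g))

    expanded-max : ∀ {I} → Optimal I → ∀ T → LegalDominating (JAdj n m R) T → length T ≤ length (expanded I)
    expanded-max opt T legal = ℤₚ.drop‿+≤+ (subst (+ length T ℤ.≤_) (sym (expanded-length opt)) (legal≤ opt legal))

theorem2 : (n m : ℕ) → 1 ≤ m → (h : 2 * (m + 1) ≤ n)
    → (R : Fin n → FinGraph) → (∀ i → 0 < FinGraph.size (R i))
    → (g : Fin n → ℕ) → (∀ i → GrundyNumber (FinGraph.Adj (R i)) (g i))
    → (Σ (List (Fin n)) λ I* → IsI2 n m I*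
    × (∀ I → IsI2 n m I → obj m g I ℤ.≤ obj m g I*)
    × Σ ℕ (λ k → GrundyNumber (JAdj n m R) k × + k ≡ obj m g I* ℤ.+ + n))
    × ((S : (i : Fin n) → List (Fin (FinGraph.size (R i))))
    → (∀ i → GrundySeq (FinGraph.Adj (R i)) (S i))
    → (c : (i : Fin n) → Fin (FinGraph.size (R i)))
    → (I* : List (Fin n)) → IsI2 n m I*
    → (∀ I → IsI2 n m I → obj m g I ℤ.≤ obj m g I*)
    → GrundySeq (JAdj n m R) (expand n m R c S I* (SC n m {{nz {n} {m} h}} I*)))
theorem2 n m 1≤m h R nonempty g gn = value , sequence
  where
  instance
    n≢0 : NonZero n
    n≢0 = nz {n} {m} h
  open Main n m 1≤m h R nonempty g gn

  value : Σ (List (Fin n)) λ I* → IsI2 n m I* × (∀ I → IsI2 n m I → obj m g I ℤ.≤ obj m g I*)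
        × Σ ℕ (λ k → GrundyNumber (JAdj n m R) k × + k ≡ obj m g I* ℤ.+ + n)
  value with optimum
  ... | I , opt@(I∈I2 , max) = I , I∈I2 , max , length (expanded S S-legal S≡g c I)
      , ((expanded S S-legal S≡g c I , expanded-legal S S-legal S≡g c I∈I2 , refl) , expanded-max S S-legal S≡g c opt)
      , expanded-length S S-legal S≡g c opt
    where
    S       = λ i → proj₁ (proj₁ (gn i))
    S-legal = λ i → proj₁ (proj₂ (proj₁ (gn i)))
    S≡g     = λ i → proj₂ (proj₂ (proj₁ (gn i)))
    c       = λ i → Fin.fromℕ< (nonempty i)

  sequence : (S : (i : Fin n) → List (Fin (FinGraph.size (R i)))) → (∀ i → GrundySeq (FinGraph.Adj (R i)) (S i)) →
    (c : (i : Fin n) → Fin (FinGraph.size (R i))) → (I* : List (Fin n)) → IsI2 n m I* →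
    (∀ I → IsI2 n m I → obj m g I ℤ.≤ obj m g I*) → GrundySeq (JAdj n m R) (expand n m R c S I* (SC n m I*))
  sequence S S-grundy c I I∈I2 max =
    expanded-legal S S-legal S≡g c I∈I2 , expanded-max S S-legal S≡g c (I∈I2 , max)
    where
    S-legal : ∀ i → LegalDominating (FinGraph.Adj (R i)) (S i)
    S-legal i = proj₁ (S-grundy i)
    S≡g : ∀ i → length (S i) ≡ g i
    -- Two sequences of maximum length bound each other, so the given `S i` has length `g i`.
    S≡g i with gn i
    ... | (T , T-legal , |T|≡g) , g-max =
      ≤-antisym (g-max (S i) (S-legal i)) (subst (_≤ length (S i)) |T|≡g (proj₂ (S-grundy i) T T-legal))
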